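{- Let $n\ge 1$. There is a bijection between the set of fully tiered trees of weight $0$ on the vertex set $\{1,\dots,n\}$ and the set of complete nonambiguous trees with $n-1$ internal vertices.
   Context: A fully tiered tree on $\{1,\dots,n\}$ is a tree $T$ on that vertex set together with a bijection $t\colon\{1,\dots,n\}\to\{1,\dots,n\}$ (the tiering function) such that whenever $v,v'$ are adjacent and $v>v'$ we have $t(v)>t(v')$. The weight $w(T)$ of a tree with integer vertex labels and tiering function $t$ (satisfying the same adjacency condition) is defined recursively: if $T$ has one vertex, $w(T)=0$; otherwise let $v$ be the vertex with smallest label, $T_1,\dots,T_l$ the components after deleting $v$ (with restricted labels and tiering), $u_i\in T_i$ the neighbor of $v$ in $T_i$, and $w_i$ the number of $u\in T_i$ with $t(u)>t(v)$ and $u<u_i$; then $w(T)=\sum_{i=1}^l (w_i+w(T_i))$. A nonambiguous tree is a finite set $A\subset \mathbb Z_{>0}\times\mathbb Z_{>0}$, writing $p=(X(p),Y(p))$, such that: (1) $(1,1)\in A$ (the root); (2) for every $p\in A$ other than the root, either there is some $q\in A$ with $Y(q)=Y(p)$ and $X(q)<X(p)$, or there is some $q\in A$ with $X(q)=X(p)$ and $Y(q)<Y(p)$, but not both; (3) no empty lines: if some point of $A$ has $X$-coordinate $x$ (resp. $Y$-coordinate $y$), then for every $x'<x$ (resp. $y'<y$) some point of $A$ has $X$-coordinate $x'$ (resp. $Y$-coordinate $y'$). Such $A$ is a binary tree in which the parent of a non-root point $p$ is the nearest point of $A$ preceding $p$ in its row (smaller $X$, same $Y$) or in its column (same $X$,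 smaller $Y$). It is complete if every point has $0$ or $2$ children; internal vertices are those with children. -}

module Defs where

open import Data.Nat using (ℕ; zero; suc; _+_; _≤_; _<_; _<ᵇ_; _≡ᵇ_)
open import Data.Bool using (Bool; true; false; T; _∧_; _∨_; not; if_then_else_)
open import Data.Fin using (Fin; toℕ)
open import Data.List using (List; []; _∷_; _++_; length; allFin; foldr; map)
open import Data.Nat.ListAction using (sum)
open import Data.List.Membership.Propositional using (_∈_)
open import Data.List.Relation.Unary.Linked using (Linked)
open import Data.List.Relation.Unary.Unique.Propositional using (Unique)
open import Data.Maybe using (Maybe; just; nothing)
open import Data.Product using (Σ; ∃; _×_; _,_; proj₁; proj₂)
open import Data.Sum using (_⊎_)
open import Data.Empty using (⊥)
open import Relation.Nullary using (¬_)
open import Relation.Binary.PropositionalEquality using (_≡_; _≢_; refl; sym; trans)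
open import Relation.Binary.Bundles using (Setoid)
open import Function.Definitions using (Bijective)

-- Graph basics.  Vertex i : Fin n stands for the label toℕ i + 1, so the
-- order on labels is the order of toℕ.

module _ {n : ℕ} (adj : Fin n → Fin n → Bool) where

  data Walk : Fin n → Fin n → Set where
    here : ∀ {u} → Walk u u
    step : ∀ {u w v} → T (adj u w) → Walk w v → Walk u v

  Connected : Set
  Connected = ∀ u v → Walk u v

  HasCycle : Set
  HasCycle = Σ (Fin n) λ a → Σ (Fin n) λ b → Σ (Fin n) λ c → Σ (List (Fin n)) λ rest →
    Unique (a ∷ b ∷ c ∷ rest) × Linked (λ x y → T (adj x y)) ((a ∷ b ∷ c ∷ rest) ++ (a ∷ []))

  record IsTree : Set where
    field
      symmetric   : ∀ u v → adj u v ≡ adj v u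
      irreflexive : ∀ u → adj u u ≡ false
      connected   : Connected
      acyclic     : ¬ HasCycle

record FullyTieredTree (n : ℕ) : Set where
  field
    adj     : Fin n → Fin n → Bool
    isTree  : IsTree adj
    tier    : Fin n → Fin n
    tierBij : Bijective _≡_ _≡_ tier
    tiered  : ∀ v v' → T (adj v v') → toℕ v' < toℕ v → toℕ (tier v') < toℕ (tier v)

-- The weight, computed on vertex subsets S (subtrees, keeping the original
-- labels and tiering), by recursion with fuel.

_<F_ : ∀ {n} → Fin n → Fin n → Bool
x <F y = toℕ x <ᵇ toℕ y

_=F_ : ∀ {n} → Fin n → Fin n → Bool
x =F y = toℕ x ≡ᵇ toℕ y

count : ∀ {n} → (Fin n → Bool) → ℕ
count {n} P = foldr (λ x k → if P x then suc k else k) 0 (allFin n)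

minOf : ∀ {n} → (Fin n → Bool) → Maybe (Fin n)
minOf {n} S = foldr (λ x r → if S x then just x else r) nothing (allFin n)

module Weight {n : ℕ} (adj : Fin n → Fin n → Bool) (t : Fin n → Fin n) where

  expand : (Fin n → Bool) → (Fin n → Bool) → (Fin n → Bool)
  expand S R x = R x ∨ (S x ∧ foldr (λ y b → (R y ∧ adj y x) ∨ b) false (allFin n))

  iter : ℕ → (Fin n → Bool) → (Fin n → Bool) → (Fin n → Bool)
  iter zero    S R = R
  iter (suc k) S R = iter k S (expand S R)

  -- the connected component of u in the induced subgraph on S (u ∈ S)
  component : (Fin n → Bool) → Fin n → (Fin n → Bool)
  component S u = iter n S (λ x → x =F u)

  remove : (Fin n → Bool) → Fin n → (Fin n → Bool)
  remove S v x = S x ∧ not (x =F v)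

  wt : ℕ → (Fin n → Bool) → ℕ
  wt zero    S = 0
  wt (suc f) S with minOf S
  ... | nothing = 0
  ... | just v  = sum (map term (filter? (allFin n)))
    where
    S' = remove S v
    filter? : List (Fin n) → List (Fin n)
    filter? = foldr (λ u us → if S u ∧ adj v u then u ∷ us else us) []
    -- u is the neighbour of v in the component Tᵤ of S ∖ {v}
    term : Fin n → ℕ
    term u = count (λ x → component S' u x ∧ (t v <F t x) ∧ (x <F u))
             + wt f (component S' u)

weight : ∀ {n} → FullyTieredTree n → ℕ
weight {n} T = Weight.wt (FullyTieredTree.adj T) (FullyTieredTree.tier T) n (λ _ → true)

FTT₀ : ℕ → Setoid _ _
FTT₀ n = record
  { Carrier = Σ (FullyTieredTree n) (λ T → weight T ≡ 0)
  ; _≈_ = λ A B → (∀ u v → FullyTieredTree.adj (proj₁ A) u v ≡ FullyTieredTree.adj (proj₁ B) u v)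
                × (∀ v → FullyTieredTree.tier (proj₁ A) v ≡ FullyTieredTree.tier (proj₁ B) v)
  ; isEquivalence = record
    { refl  = (λ _ _ → refl) , (λ _ → refl)
    ; sym   = λ (p , q) → (λ u v → sym (p u v)) , (λ v → sym (q v))
    ; trans = λ (p , q) (p' , q') → (λ u v → trans (p u v) (p' u v)) , (λ v → trans (q v) (q' v))
    }
  }

-- Nonambiguous trees.  A finite subset of ℤ>0 × ℤ>0 is given by a list of
-- points (of ℕ × ℕ, required positive); lists with the same members are
-- identified.

Point : Set
Point = ℕ × ℕ

X Y : Point → ℕ
X = proj₁
Y = proj₂

RowPred ColPred : List Point → Point → Set
RowPred A p = ∃ λ q → q ∈ A × Y q ≡ Y p × X q < X p
ColPred A p = ∃ λ q → q ∈ A × X q ≡ X p × Y q < Y p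

record IsNonambiguous (A : List Point) : Set where
  field
    positive : ∀ {p} → p ∈ A → 1 ≤ X p × 1 ≤ Y p
    root     : (1 , 1) ∈ A
    unambig  : ∀ {p} → p ∈ A → p ≢ (1 , 1) →
               (RowPred A p ⊎ ColPred A p) × ¬ (RowPred A p × ColPred A p)
    noEmptyX : ∀ {p} → p ∈ A → ∀ x' → 1 ≤ x' → x' < X p → ∃ λ q → q ∈ A × X q ≡ x'
    noEmptyY : ∀ {p} → p ∈ A → ∀ y' → 1 ≤ y' → y' < Y p → ∃ λ q → q ∈ A × Y q ≡ y'

Child : List Point → Point → Point → Set
Child A p q = q ∈ A ×
  ( (Y q ≡ Y p × X p < X q × (∀ r → r ∈ A → Y r ≡ Y q → X p < X r → ¬ (X r < X q)))
  ⊎ (X q ≡ X p × Y p < Y q × (∀ r → r ∈ A → X r ≡ X q → Y p < Y r → ¬ (Y r < Y q))))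

Complete : List Point → Set
Complete A = ∀ p → p ∈ A →
  (∀ q → ¬ Child A p q)
  ⊎ (Σ Point λ q₁ → Σ Point λ q₂ → q₁ ≢ q₂ × Child A p q₁ × Child A p q₂ ×
       (∀ q → Child A p q → q ≡ q₁ ⊎ q ≡ q₂))

Internal : List Point → Point → Set
Internal A p = ∃ λ q → Child A p q

InternalCount : List Point → ℕ → Set
InternalCount A k = Σ (List Point) λ L → Unique L ×
  (∀ p → (p ∈ L → p ∈ A × Internal A p) × (p ∈ A × Internal A p → p ∈ L)) ×
  length L ≡ k

CNT : ℕ → Setoid _ _
CNT k = record
  { Carrier = Σ (List Point) (λ A → IsNonambiguous A × Complete A × InternalCount A k)
  ; _≈_ = λ A B → ∀ p → (p ∈ proj₁ A → p ∈ proj₁ B) × (p ∈ proj₁ B → p ∈ proj₁ A)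
  ; isEquivalence = record
    { refl  = λ p → (λ x → x) , (λ x → x)
    ; sym   = λ e p → proj₂ (e p) , proj₁ (e p)
    ; trans = λ e f p → (λ x → proj₁ (f p) (proj₁ (e p) x)) , (λ x → proj₂ (e p) (proj₂ (f p) x))
    }
  }

-- Both families are encoded by the same data: a tiering t together with an increasing
-- tree on the labels (every non-root u has a parent par u < u) such that some descendant
-- of u has a higher tier than par u.  Deleting the least label v of a tiered tree leaves
-- components, and the children of v are their least labels; the weight vanishes exactly
-- when, in each component, the neighbour of v is the least label of tier > t(v), so the
-- tree is recovered from the data.  In a complete nonambiguous tree every row and every
-- column contains exactly one leaf, which gives the tiering, with the rows read from the
-- bottom; deleting a column leaves the subtrees hanging to its right, and par u is the
-- column of the left neighbour of the topmost point of column u.  That point lies in the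
-- row of the descendant of u of highest tier, so this tree is recovered as well.

module Submission where

open import Defs
open import Data.Bool using (Bool; true; false; T; _∧_; _∨_; not; if_then_else_)
open import Data.Bool.Properties using (T-∧; T-∨; T?; T-≡)
open import Data.Empty using (⊥; ⊥-elim)
open import Data.Fin using (Fin; zero; suc; toℕ; fromℕ<; opposite) renaming (_<_ to _<ᶠ_; _≤_ to _≤ᶠ_; _>_ to _>ᶠ_)
open import Data.Fin.Induction using (>-wellFounded)
open import Data.Fin.Properties using (toℕ-injective; toℕ<n; any?; injective⇒≤; toℕ-fromℕ<; opposite-involutive; opposite-prop)
  renaming (_≟_ to _≟ᶠ_; _<?_ to _<ᶠ?_; _≤?_ to _≤ᶠ?_)
open import Data.List using (List; []; _∷_; _++_; length; allFin; foldr; map; lookup)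
open import Data.List.Membership.Propositional using (_∈_)
open import Data.List.Membership.Propositional.Properties
  using (∈-allFin; ∈-map⁺; ∈-map⁻; ∈-++⁺ˡ; ∈-++⁺ʳ; ∈-++⁻; ∈-lookup; ∈-∃++)
open import Data.List.Properties using (length-map; length-tabulate; ++-assoc; ++-identityʳ)
open import Data.List.Relation.Unary.All using (All; []; _∷_)
import Data.List.Relation.Unary.All as All
open import Data.List.Relation.Unary.AllPairs using (AllPairs; []; _∷_)
import Data.List.Relation.Unary.AllPairs.Properties as AllPairs
open import Data.List.Relation.Unary.Any using (here; there; index)
import Data.List.Relation.Unary.Any.Properties as Any
open import Data.List.Relation.Unary.Linked using (Linked; []; [-]; _∷_)
open import Data.List.Relation.Unary.Unique.Propositional using (Unique)
import Data.List.Relation.Unary.Unique.Propositional.Properties as Unique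
import Data.List.Relation.Binary.Permutation.Setoid.Properties as Permutation
open import Data.Maybe using (Maybe; just; nothing)
open import Data.Nat using (ℕ; zero; suc; _+_; _∸_; _≤_; _<_; z≤n; s≤s; _<?_)
open import Data.Nat.Induction using (<-wellFounded)
open import Data.Nat.ListAction using (sum)
open import Data.Nat.Properties
  using (≤-refl; ≤-trans; ≤-antisym; ≤-total; ≤-pred; <-irrefl; <-≤-trans; ≤-<-trans; <⇒≤; <⇒≱; ≮⇒≥; ≰⇒>; ≤∧≢⇒<; <-cmp;
         m+n≡0⇒m≡0; m+n≡0⇒n≡0; +-suc; ≡⇒≡ᵇ; ≡ᵇ⇒≡; <⇒<ᵇ; <ᵇ⇒<; suc-injective; +-identityʳ; m≤n⇒m<n∨m≡n; ∸-monoʳ-<; ∸-monoʳ-≤)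
import Data.Nat.Properties as ℕ
open import Data.Product using (Σ; ∃; ∃₂; _×_; _,_; proj₁; proj₂)
open import Data.Sum using (_⊎_; inj₁; inj₂; [_,_]′)
open import Data.Unit using (⊤; tt)
open import Function using (_∘_; id)
open import Function.Bundles using (Bijection; Equivalence)
open import Function.Definitions using (Bijective; Injective; Surjective)
open import Function.Properties.Bijection using (Bijection⇒Inverse)
import Function.Properties.Inverse as Inverse
open import Function.Properties.Inverse using (Inverse⇒Bijection)
open import Induction.WellFounded using (Acc; acc)
open import Relation.Binary.Bundles using (Setoid)
open import Relation.Binary.Definitions using (tri<; tri≈; tri>)
open import Relation.Binary.PropositionalEquality using (_≡_; _≢_; refl; sym; trans; cong; cong₂; subst; subst₂; setoid)
open import Relation.Nullary using (¬_; Dec; yes; no; contradiction)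
open import Relation.Nullary.Decidable using (⌊_⌋; toWitness; fromWitness; _×-dec_; _⊎-dec_; map′)
open Equivalence using (to; from)

-- The inequality in the data is the tiering condition seen from both sides. In a tiered tree, the
-- neighbour of `par u` in the component of `u` has a larger label, hence a higher tier. In the
-- grid, with rows read from the bottom, the inequality says that the branching point of column
-- `par u` lies above the leaf of that column. The weight is computed with fuel on Boolean sets.
-- `Greedy` replaces it by a statement about paths: the components left by the deletion of `v` are
-- reached along labels above `v`. Ancestry in the increasing tree thereby becomes a property of the
-- graph, namely a path on labels not less than that of the ancestor. The dimensions of a
-- nonambiguous tree are not given, only the number of its internal points, so rows and columns have
-- to be counted before a tiering can be read off.

-- Extremal elements of finite sets

module _ {A : Set} (_≼_ : A → A → Set)
         (total : ∀ x y → x ≼ y ⊎ y ≼ x)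
         (transitive : ∀ {x y z} → x ≼ y → y ≼ z → x ≼ z)
         {P : A → Set} (P? : ∀ x → Dec (P x)) where

  private
    Least : List A → Set
    Least xs = ∃ λ m → m ∈ xs × P m × (∀ {y} → y ∈ xs → P y → m ≼ y)

  none⊎least : ∀ xs → (∀ {y} → y ∈ xs → ¬ P y) ⊎ Least xs
  none⊎least [] = inj₁ λ ()
  none⊎least (x ∷ xs) with P? x | none⊎least xs
  ... | no ¬p | inj₁ none = inj₁ λ { (here refl) → ¬p ; (there y∈) → none y∈ }
  ... | no ¬p | inj₂ (m , m∈ , pm , least) =
    inj₂ (m , there m∈ , pm , λ { (here refl) p → contradiction p ¬p ; (there y∈) → least y∈ })
  ... | yes p | inj₁ none =
    inj₂ (x , here refl , p , λ { (here refl) _ → [ id , id ]′ (total x x)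
                                ; (there y∈) py → contradiction py (none y∈) })
  ... | yes p | inj₂ (m , m∈ , pm , least) with total x m
  ... | inj₁ x≼m = inj₂ (x , here refl , p , λ { (here refl) _ → [ id , id ]′ (total x x)
                                               ; (there y∈) py → transitive x≼m (least y∈ py) })
  ... | inj₂ m≼x = inj₂ (m , there m∈ , pm , λ { (here refl) _ → m≼x ; (there y∈) py → least y∈ py })

  least∈ : ∀ {xs x} → x ∈ xs → P x → Least xs
  least∈ {xs} x∈ px with none⊎least xs
  ... | inj₁ none = contradiction px (none x∈)
  ... | inj₂ l    = l

module _ {A : Set} (f : A → ℕ) {P : A → Set} (P? : ∀ x → Dec (P x)) where

  argmin∈ : ∀ {xs x} → x ∈ xs → P x → ∃ λ m → m ∈ xs × P m × (∀ {y} → y ∈ xs → P y → f m ≤ f y)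
  argmin∈ = least∈ (λ x y → f x ≤ f y) (λ x y → ≤-total (f x) (f y)) ≤-trans P?

  argmax∈ : ∀ {xs x} → x ∈ xs → P x → ∃ λ m → m ∈ xs × P m × (∀ {y} → y ∈ xs → P y → f y ≤ f m)
  argmax∈ = least∈ (λ x y → f y ≤ f x) (λ x y → ≤-total (f y) (f x)) (λ p q → ≤-trans q p) P?

module _ {n : ℕ} (f : Fin n → ℕ) {P : Fin n → Set} (P? : ∀ x → Dec (P x)) where

  argmin : ∃ P → ∃ λ m → P m × (∀ y → P y → f m ≤ f y)
  argmin (x , px) with argmin∈ f P? (∈-allFin x) px
  ... | m , _ , pm , least = m , pm , λ y → least (∈-allFin y)

  argmax : ∃ P → ∃ λ m → P m × (∀ y → P y → f y ≤ f m)
  argmax (x , px) with argmax∈ f P? (∈-allFin x) px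
  ... | m , _ , pm , most = m , pm , λ y → most (∈-allFin y)

-- Increasing trees

module Ancestry {m : ℕ} (par : Fin m → Fin (suc m)) (par≤ : ∀ i → par i ≤ᶠ i) where

  -- Paths grow at the descendant's end, where the step up is forced. Two paths to the same vertex
  -- therefore peel in lockstep, which is why its ancestors form a chain.
  data Anc (u : Fin (suc m)) : Fin (suc m) → Set where
    self : Anc u u
    up   : ∀ {i} → Anc u (par i) → Anc u (suc i)

  par<suc : ∀ i → par i <ᶠ suc i
  par<suc i = s≤s (par≤ i)

  anc-≤ : ∀ {u w} → Anc u w → u ≤ᶠ w
  anc-≤ self       = ≤-refl
  anc-≤ (up {i} a) = <⇒≤ (≤-<-trans (anc-≤ a) (par<suc i))

  anc-trans : ∀ {u v w} → Anc u v → Anc v w → Anc u w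
  anc-trans a self   = a
  anc-trans a (up b) = up (anc-trans a b)

  par-anc : ∀ i → Anc (par i) (suc i)
  par-anc i = up self

  ¬suc-anc-par : ∀ {i} → ¬ Anc (suc i) (par i)
  ¬suc-anc-par {i} a = <⇒≱ (par<suc i) (anc-≤ a)

  anc-chain : ∀ {a b w} → Anc a w → Anc b w → Anc a b ⊎ Anc b a
  anc-chain self   b      = inj₂ b
  anc-chain (up a) self   = inj₁ (up a)
  anc-chain (up a) (up b) = anc-chain a b

  anc-par : ∀ {a i} → Anc a (suc i) → a ≢ suc i → Anc a (par i)
  anc-par self   a≢ = contradiction refl a≢
  anc-par (up a) _  = a

  anc? : ∀ u w → Dec (Anc u w)
  anc? u w = go w (<-wellFounded (toℕ w))
    where
    go : ∀ w → Acc _<_ (toℕ w) → Dec (Anc u w)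
    go w a with u ≟ᶠ w
    go w a | yes refl = yes self
    go zero a | no u≢w = no λ { self → u≢w refl }
    go (suc i) (acc rs) | no u≢w = map′ up (λ a → anc-par a u≢w) (go (par i) (rs (par<suc i)))

  zero-anc : ∀ w → Anc zero w
  zero-anc w = go w (<-wellFounded (toℕ w))
    where
    go : ∀ w → Acc _<_ (toℕ w) → Anc zero w
    go zero    _        = self
    go (suc i) (acc rs) = up (go (par i) (rs (par<suc i)))

  -- By `anc-chain` one of the two is an ancestor of the other. If they differed, it would be an
  -- ancestor of the other's parent, which is its own parent.
  siblings : ∀ {i j w} → par i ≡ par j → Anc (suc i) w → Anc (suc j) w → i ≡ j
  siblings {i} {j} e a b with anc-chain a b
  ... | inj₁ self   = refl
  ... | inj₁ (up c) = contradiction (subst (Anc (suc i)) (sym e) c) ¬suc-anc-par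
  ... | inj₂ self   = refl
  ... | inj₂ (up c) = contradiction (subst (Anc (suc j)) e c) ¬suc-anc-par

  child-towards : ∀ {a w} → Anc a w → a ≡ w ⊎ ∃ λ i → par i ≡ a × Anc (suc i) w
  child-towards self = inj₁ refl
  child-towards (up {i} a) with child-towards a
  ... | inj₁ a≡        = inj₂ (i , sym a≡ , self)
  ... | inj₂ (j , e , b) = inj₂ (j , e , up b)

-- Components of induced subgraphs

∨-elim : ∀ {x y} → T (x ∨ y) → T x ⊎ T y
∨-elim {x} = to (T-∨ {x})

∨-introˡ : ∀ {x y} → T x → T (x ∨ y)
∨-introˡ {x} p = from (T-∨ {x}) (inj₁ p)

∨-introʳ : ∀ {x y} → T y → T (x ∨ y)
∨-introʳ {x} p = from (T-∨ {x}) (inj₂ p)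

∧-elim : ∀ {x y} → T (x ∧ y) → T x × T y
∧-elim {x} = to (T-∧ {x})

∧-intro : ∀ {x y} → T x → T y → T (x ∧ y)
∧-intro {x} p q = from (T-∧ {x}) (p , q)

not-intro : ∀ {x} → ¬ T x → T (not x)
not-intro {true}  ¬t = ¬t tt
not-intro {false} _  = tt

not-elim : ∀ {x} → T (not x) → ¬ T x
not-elim {false} _ ()

T-injective : ∀ {x y} → (T x → T y) → (T y → T x) → x ≡ y
T-injective {true}  {true}  _ _ = refl
T-injective {true}  {false} f _ = ⊥-elim (f tt)
T-injective {false} {true}  _ g = ⊥-elim (g tt)
T-injective {false} {false} _ _ = refl

foldr-∨⁺ : ∀ {A : Set} (g : A → Bool) {x xs} → x ∈ xs → T (g x) → T (foldr (λ y b → g y ∨ b) false xs)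
foldr-∨⁺ g {xs = y ∷ _} (here refl) p = ∨-introˡ {g y} p
foldr-∨⁺ g {xs = y ∷ _} (there x∈)  p = ∨-introʳ {g y} (foldr-∨⁺ g x∈ p)

foldr-∨⁻ : ∀ {A : Set} (g : A → Bool) xs → T (foldr (λ y b → g y ∨ b) false xs) → ∃ λ x → T (g x)
foldr-∨⁻ g (y ∷ xs) p with ∨-elim {g y} p
... | inj₁ q = y , q
... | inj₂ q = foldr-∨⁻ g xs q

=F⇒≡ : ∀ {n} {x y : Fin n} → T (x =F y) → x ≡ y
=F⇒≡ {x = x} {y} p = toℕ-injective (≡ᵇ⇒≡ (toℕ x) (toℕ y) p)

=F-refl : ∀ {n} (x : Fin n) → T (x =F x)
=F-refl x = ≡⇒≡ᵇ (toℕ x) (toℕ x) refl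

lookup-injective : ∀ {A : Set} {xs : List A} → Unique xs → ∀ i j → lookup xs i ≡ lookup xs j → i ≡ j
lookup-injective (_ ∷ _)  zero    zero    _ = refl
lookup-injective (x∉ ∷ _) zero    (suc j) e = contradiction e (All.lookup x∉ (∈-lookup j))
lookup-injective (x∉ ∷ _) (suc i) zero    e = contradiction (sym e) (All.lookup x∉ (∈-lookup i))
lookup-injective (_ ∷ u)  (suc i) (suc j) e = cong suc (lookup-injective u i j e)

Unique⇒length≤ : ∀ {n} {xs : List (Fin n)} → Unique xs → length xs ≤ n
Unique⇒length≤ u = injective⇒≤ (λ {i} {j} → lookup-injective u i j)

module _ {n : ℕ} (adj : Fin n → Fin n → Bool) where

  -- As in `iter`, the starting vertex is not tested: `P` is required only of the vertices reached
  -- later, and paths grow at the far end as under `expand`.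
  data Reach (P : Fin n → Set) (u : Fin n) : Fin n → Set where
    start : Reach P u u
    _▸_   : ∀ {y x} → Reach P u y → T (adj y x) × P x → Reach P u x

module _ {n : ℕ} {adj : Fin n → Fin n → Bool} where

  reach-map : ∀ {P Q : Fin n → Set} {u x} → (∀ {y} → P y → Q y) → Reach adj P u x → Reach adj Q u x
  reach-map f start         = start
  reach-map f (r ▸ (a , p)) = reach-map f r ▸ (a , f p)

  reach-trans : ∀ {P : Fin n → Set} {u v x} → Reach adj P u v → Reach adj P v x → Reach adj P u x
  reach-trans r start   = r
  reach-trans r (s ▸ e) = reach-trans r s ▸ e

  reach-end : ∀ {P : Fin n → Set} {u x} → P u → Reach adj P u x → P x
  reach-end pu start         = pu
  reach-end pu (_ ▸ (_ , p)) = p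

  reach-sym : ∀ {P : Fin n → Set} → (∀ u v → adj u v ≡ adj v u) → ∀ {u x} → P u → Reach adj P u x → Reach adj P x u
  reach-sym sy pu start = start
  reach-sym sy pu (_▸_ {y} {x} r (a , px)) =
    reach-trans (start ▸ (subst T (sy y x) a , reach-end pu r)) (reach-sym sy pu r)

  walk-trans : ∀ {u v w} → Walk adj u v → Walk adj v w → Walk adj u w
  walk-trans here       q = q
  walk-trans (step a p) q = step a (walk-trans p q)

  walk-sym : (∀ u v → adj u v ≡ adj v u) → ∀ {u v} → Walk adj u v → Walk adj v u
  walk-sym sy here               = here
  walk-sym sy (step {u} {w} a p) = walk-trans (walk-sym sy p) (step (subst T (sy u w) a) here)

  reach⇒walk : ∀ {P : Fin n → Set} {u x} → Reach adj P u x → Walk adj u x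
  reach⇒walk start         = here
  reach⇒walk (r ▸ (a , _)) = walk-trans (reach⇒walk r) (step a here)

  walk⇒reach : ∀ {P : Fin n → Set} → (∀ x → P x) → ∀ {u x} → Walk adj u x → Reach adj P u x
  walk⇒reach p here       = start
  walk⇒reach p (step a w) = reach-trans (start ▸ (a , p _)) (walk⇒reach p w)

module Component {n : ℕ} (adj : Fin n → Fin n → Bool) (t : Fin n → Fin n) where
  open Weight adj t

  expand⁻ : ∀ S R x → T (expand S R x) → T (R x) ⊎ T (S x) × ∃ λ y → T (R y) × T (adj y x)
  expand⁻ S R x p with ∨-elim {R x} p
  ... | inj₁ r = inj₁ r
  ... | inj₂ q with ∧-elim {S x} q
  ... | s , f with foldr-∨⁻ _ (allFin n) f
  ... | y , ra = inj₂ (s , y , ∧-elim {R y} ra)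

  expand-step : ∀ S R {x y} → T (R y) → T (adj y x) → T (S x) → T (expand S R x)
  expand-step S R {x} {y} r a s =
    ∨-introʳ {R x} (∧-intro {S x} s (foldr-∨⁺ _ (∈-allFin y) (∧-intro {R y} r a)))

  iter-suc : ∀ k S R {x} → T (iter k S R x) → T (iter (suc k) S R x)
  iter-suc zero    S R {x} r = ∨-introˡ {R x} r
  iter-suc (suc k) S R     r = iter-suc k S (expand S R) r

  iter-grow : ∀ k S R {x} → T (R x) → T (iter k S R x)
  iter-grow zero    S R r = r
  iter-grow (suc k) S R r = iter-suc k S R (iter-grow k S R r)

  iter-step : ∀ k S R {x y} → T (iter k S R y) → T (adj y x) → T (S x) → T (iter (suc k) S R x)
  iter-step zero    S R r a s = expand-step S R r a s
  iter-step (suc k) S R r a s = iter-step k S (expand S R) r a s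

  iter⁻ : ∀ k S R x → T (iter (suc k) S R x) →
          T (iter k S R x) ⊎ T (S x) × ∃ λ y → T (iter k S R y) × T (adj y x)
  iter⁻ zero    S R x p = expand⁻ S R x p
  iter⁻ (suc k) S R x p = iter⁻ k S (expand S R) x p

  -- A vertex first reached at stage k ends a chain of vertices first reached at
  -- stages 0, …, k; these are distinct, so k < n.
  fresh-chain : ∀ k S R x → T (iter (suc k) S R x) → ¬ T (iter k S R x) →
                ∃ λ xs → length xs ≡ suc k × Unique xs × All (λ y → T (iter k S R y)) xs
  fresh-chain zero S R x p ¬q with iter⁻ zero S R x p
  ... | inj₁ q = contradiction q ¬q
  ... | inj₂ (_ , y , r , _) = y ∷ [] , refl , [] ∷ [] , r ∷ []
  fresh-chain (suc k) S R x p ¬q with iter⁻ (suc k) S R x p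
  ... | inj₁ q = contradiction q ¬q
  ... | inj₂ (s , y , r , a) with fresh-chain k S R y r (λ r′ → ¬q (iter-step k S R r′ a s))
  ... | xs , l , u , all = y ∷ xs , cong suc l
      , All.map (λ { z refl → ¬q (iter-step k S R z a s) }) all ∷ u
      , r ∷ All.map (iter-suc k S R) all

  iter-saturates : ∀ S R x → T (iter (suc n) S R x) → T (iter n S R x)
  iter-saturates S R x p with T? (iter n S R x)
  ... | yes q = q
  ... | no ¬q with fresh-chain n S R x p ¬q
  ... | xs , l , u , _ = contradiction (subst (_≤ n) l (Unique⇒length≤ u)) (<⇒≱ ≤-refl)

  InS : (Fin n → Bool) → Fin n → Set
  InS S x = T (S x)

  reach⇒component : ∀ S {u x} → Reach adj (InS S) u x → T (component S u x)
  reach⇒component S {u} start = iter-grow n S (λ x → x =F u) (=F-refl u)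
  reach⇒component S (r ▸ (a , s)) =
    iter-saturates S _ _ (iter-step n S _ (reach⇒component S r) a s)

  component⇒reach : ∀ S {u x} → T (component S u x) → Reach adj (InS S) u x
  component⇒reach S {u} = go n
    where
    go : ∀ k {x} → T (iter k S (λ y → y =F u) x) → Reach adj (InS S) u x
    go zero    {x} p with =F⇒≡ {x = x} p
    ... | refl = start
    go (suc k) {x} p with iter⁻ k S _ x p
    ... | inj₁ q               = go k q
    ... | inj₂ (s , y , r , a) = go k r ▸ (a , s)

-- Vanishing of the weight

module _ {n : ℕ} (S : Fin n → Bool) where

  private
    pick : Fin n → Maybe (Fin n) → Maybe (Fin n)
    pick x r = if S x then just x else r

  foldr-pick-just : ∀ {xs v} → AllPairs _<ᶠ_ xs → foldr pick nothing xs ≡ just v →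
                    T (S v) × (∀ {x} → x ∈ xs → T (S x) → v ≤ᶠ x)
  foldr-pick-just {x ∷ xs} (x< ∷ ps) e with S x in eq
  foldr-pick-just {x ∷ xs} (x< ∷ ps) refl | true =
    from T-≡ eq , λ { (here refl) _ → ≤-refl ; (there y∈) _ → <⇒≤ (All.lookup x< y∈) }
  foldr-pick-just {x ∷ xs} (x< ∷ ps) e | false with foldr-pick-just ps e
  ... | s , least = s , λ { (here refl) sx → contradiction (trans (sym (to T-≡ sx)) eq) λ ()
                          ; (there y∈) sy → least y∈ sy }

  foldr-pick-nothing : ∀ {xs} → foldr pick nothing xs ≡ nothing → ∀ {x} → x ∈ xs → ¬ T (S x)
  foldr-pick-nothing {x ∷ xs} e x∈ sx with S x in eq
  foldr-pick-nothing {x ∷ xs} e (here refl) sx | false = contradiction (trans (sym (to T-≡ sx)) eq) λ ()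
  foldr-pick-nothing {x ∷ xs} e (there x∈)  sx | false = foldr-pick-nothing e x∈ sx

  minOf-just : ∀ {v} → minOf S ≡ just v → T (S v) × (∀ x → T (S x) → v ≤ᶠ x)
  minOf-just e with foldr-pick-just (AllPairs.tabulate⁺-< id) e
  ... | s , least = s , λ x → least (∈-allFin x)

  minOf-nothing : minOf S ≡ nothing → ∀ x → ¬ T (S x)
  minOf-nothing e x = foldr-pick-nothing e (∈-allFin x)

module _ {A : Set} (b : A → Bool) where

  private
    keep : A → List A → List A
    keep x xs = if b x then x ∷ xs else xs

  foldr-keep⁺ : ∀ {xs x} → x ∈ xs → T (b x) → x ∈ foldr keep [] xs
  foldr-keep⁺ {y ∷ xs} x∈ bx with b y in eq
  foldr-keep⁺ {y ∷ xs} (here refl) bx | true  = here refl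
  foldr-keep⁺ {y ∷ xs} (there x∈)  bx | true  = there (foldr-keep⁺ x∈ bx)
  foldr-keep⁺ {y ∷ xs} (here refl) bx | false = contradiction (trans (sym (to T-≡ bx)) eq) λ ()
  foldr-keep⁺ {y ∷ xs} (there x∈)  bx | false = foldr-keep⁺ x∈ bx

  foldr-keep⁻ : ∀ xs {x} → x ∈ foldr keep [] xs → T (b x)
  foldr-keep⁻ (y ∷ xs) x∈ with b y in eq
  foldr-keep⁻ (y ∷ xs) (here refl) | true  = from T-≡ eq
  foldr-keep⁻ (y ∷ xs) (there x∈)  | true  = foldr-keep⁻ xs x∈
  foldr-keep⁻ (y ∷ xs) x∈          | false = foldr-keep⁻ xs x∈

module _ {A : Set} (P : A → Bool) where

  private
    tally : A → ℕ → ℕ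
    tally x k = if P x then suc k else k

  foldr-tally≡0⁻ : ∀ {xs} → foldr tally 0 xs ≡ 0 → ∀ {x} → x ∈ xs → ¬ T (P x)
  foldr-tally≡0⁻ {x ∷ xs} e x∈ p with P x in eq
  foldr-tally≡0⁻ {x ∷ xs} e (here refl) p | false = contradiction (trans (sym (to T-≡ p)) eq) λ ()
  foldr-tally≡0⁻ {x ∷ xs} e (there x∈)  p | false = foldr-tally≡0⁻ e x∈ p

  foldr-tally≡0⁺ : ∀ xs → (∀ x → ¬ T (P x)) → foldr tally 0 xs ≡ 0
  foldr-tally≡0⁺ []       none = refl
  foldr-tally≡0⁺ (x ∷ xs) none with P x in eq
  ... | true  = contradiction (from T-≡ eq) (none x)
  ... | false = foldr-tally≡0⁺ xs none

sum-map≡0⁻ : ∀ {A : Set} (g : A → ℕ) xs → sum (map g xs) ≡ 0 → ∀ {x} → x ∈ xs → g x ≡ 0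
sum-map≡0⁻ g (x ∷ xs) e (here refl) = m+n≡0⇒m≡0 (g x) e
sum-map≡0⁻ g (x ∷ xs) e (there x∈)  = sum-map≡0⁻ g xs (m+n≡0⇒n≡0 (g x) e) x∈

sum-map≡0⁺ : ∀ {A : Set} (g : A → ℕ) xs → (∀ {x} → x ∈ xs → g x ≡ 0) → sum (map g xs) ≡ 0
sum-map≡0⁺ g []       z = refl
sum-map≡0⁺ g (x ∷ xs) z = cong₂ _+_ (z (here refl)) (sum-map≡0⁺ g xs (z ∘ there))

module _ {n : ℕ} (adj : Fin n → Fin n → Bool) (t : Fin n → Fin n) where

  -- Every summand w_i of the weight vanishes.
  Greedy : Set
  Greedy = ∀ {v u x} → T (adj v u) → v <ᶠ u → Reach adj (v <ᶠ_) u x → t v <ᶠ t x → u ≤ᶠ x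

module WeightZero {n : ℕ} (adj : Fin n → Fin n → Bool) (t : Fin n → Fin n)
  (symmetric : ∀ u v → adj u v ≡ adj v u) (irreflexive : ∀ u → adj u u ≡ false) where
  open Weight adj t
  open Component adj t

  adj⇒≢ : ∀ {u v} → T (adj u v) → u ≢ v
  adj⇒≢ {u} a refl = contradiction (trans (sym (to T-≡ a)) (irreflexive u)) λ ()

  remove⁺ : ∀ {S v x} → T (S x) → x ≢ v → T (remove S v x)
  remove⁺ {S} {v} {x} s x≢v = ∧-intro {S x} s (not-intro (λ e → x≢v (=F⇒≡ e)))

  remove⁻ : ∀ S v x → T (remove S v x) → T (S x) × x ≢ v
  remove⁻ S v x p with ∧-elim {S x} p
  ... | s , q = s , λ { refl → not-elim q (=F-refl x) }

  -- Valid for every `S` and every fuel: once the minimum `v` of `S` is deleted, the components are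
  -- reached along labels above `v`, so `Greedy` rules out every vertex that could be counted.
  greedy⇒wt≡0 : Greedy adj t → ∀ f S → wt f S ≡ 0
  greedy⇒wt≡0 greedy zero    S = refl
  greedy⇒wt≡0 greedy (suc f) S with minOf S in eq
  ... | nothing = refl
  ... | just v with minOf-just S eq
  ... | sv , least = sum-map≡0⁺ _ _ term≡0
    where
    S′ = remove S v
    v< : ∀ {x} → T (S′ x) → v <ᶠ x
    v< {x} p with remove⁻ S v x p
    ... | s , x≢v = ≤∧≢⇒< (least x s) (λ e → x≢v (sym (toℕ-injective e)))
    term≡0 : ∀ {u} → u ∈ _ → _
    term≡0 {u} u∈ = cong₂ _+_ (foldr-tally≡0⁺ _ (allFin n) none) (greedy⇒wt≡0 greedy f _)
      where
      su,a : T (S u) × T (adj v u)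
      su,a = ∧-elim {S u} (foldr-keep⁻ (λ u → S u ∧ adj v u) (allFin n) u∈)
      v<u : v <ᶠ u
      v<u = v< (remove⁺ {S} (proj₁ su,a) (λ e → adj⇒≢ (proj₂ su,a) (sym e)))
      none : ∀ x → ¬ T (component S′ u x ∧ (t v <F t x) ∧ (x <F u))
      none x p with ∧-elim {component S′ u x} p
      ... | c , q with ∧-elim {t v <F t x} q
      ... | tv<tx , x<u = <⇒≱ (<ᵇ⇒< (toℕ x) (toℕ u) x<u)
        (greedy (proj₂ su,a) v<u (reach-map v< (component⇒reach S′ c)) (<ᵇ⇒< (toℕ (t v)) (toℕ (t x)) tv<tx))

  -- The invariant of the sets that the recursion visits: a nonempty `S` of this kind is a component
  -- of the graph induced on the labels from its minimum on. Letting `z` be any member avoids naming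
  -- the minimum.
  record Convex (S : Fin n → Bool) : Set where
    field
      connected : ∀ {x y} → T (S x) → T (S y) → Reach adj (InS S) x y
      closed    : ∀ {z x y} → T (S z) → T (S x) → T (adj x y) → z ≤ᶠ y → T (S y)
  open Convex

  -- The path is cut at its first visit to `v`. What precedes avoids `v`, so `u` is a neighbour of
  -- `v` in the component of `w`.
  last-before : ∀ S {v w} → T (S w) → w ≢ v → Reach adj (InS S) w v →
                ∃ λ u → T (adj u v) × T (remove S v u) × Reach adj (InS (remove S v)) w u
  last-before S {v} {w} sw w≢v r = [ (λ q → contradiction refl (proj₁ q)) , id ]′ (go r)
    where
    Entered : Set
    Entered = ∃ λ u → T (adj u v) × T (remove S v u) × Reach adj (InS (remove S v)) w u
    go : ∀ {x} → Reach adj (InS S) w x → (x ≢ v × T (remove S v x) × Reach adj (InS (remove S v)) w x) ⊎ Entered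
    go start = inj₁ (w≢v , remove⁺ {S} sw w≢v , start)
    go (_▸_ {y} {x} r (a , sx)) with go r
    ... | inj₂ done = inj₂ done
    ... | inj₁ (y≢v , sy , r′) with x ≟ᶠ v
    ... | yes refl = inj₂ (y , a , sy , r′)
    ... | no x≢v   = inj₁ (x≢v , remove⁺ {S} sx x≢v , r′ ▸ (a , remove⁺ {S} sx x≢v))

  -- The deleted minimum cannot come back through `closed`: for `z` in the component, `v < z ≤ y`
  -- keeps `y` away from `v`.
  component-convex : ∀ {S v u} → Convex S → (∀ z → T (S z) → v ≤ᶠ z) → T (remove S v u) →
                     Convex (component (remove S v) u)
  component-convex {S} {v} {u} cv least s′u = record { connected = conn ; closed = clos }
    where
    S′ = remove S v
    C  = component S′ u
    lift : ∀ {x} → Reach adj (InS S′) u x → Reach adj (InS C) u x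
    lift start               = start
    lift (r ▸ (a , s))       = lift r ▸ (a , reach⇒component S′ (r ▸ (a , s)))
    u∈C : T (C u)
    u∈C = reach⇒component S′ start
    conn : ∀ {x y} → T (C x) → T (C y) → Reach adj (InS C) x y
    conn {x} {y} cx cy = reach-trans (reach-sym symmetric u∈C (lift (component⇒reach S′ cx)))
                                     (lift (component⇒reach S′ cy))
    in-S′ : ∀ {x} → T (C x) → T (S′ x)
    in-S′ cx = reach-end s′u (component⇒reach S′ cx)
    clos : ∀ {z x y} → T (C z) → T (C x) → T (adj x y) → z ≤ᶠ y → T (C y)
    clos {z} {x} {y} cz cx a z≤y with remove⁻ S v z (in-S′ cz)
    ... | sz , z≢v = reach⇒component S′ (component⇒reach S′ cx ▸ (a , remove⁺ {S}
        (closed cv sz (proj₁ (remove⁻ S v x (in-S′ cx))) a z≤y)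
        (λ { refl → z≢v (toℕ-injective (≤-antisym z≤y (least z sz))) })))

  GreedyAt : Fin n → Set
  GreedyAt v = ∀ {u x} → T (adj v u) → v <ᶠ u → Reach adj (v <ᶠ_) u x → t v <ᶠ t x → u ≤ᶠ x

  -- Each `w` is the minimum deleted at some stage, and the count of that stage is the claim for
  -- `w`. The fuel bound survives because every deletion raises the minimum by at least one; with no
  -- fuel left it forces `S` to be empty.
  wt≡0⇒greedy : ∀ f S → Convex S → (∀ x → T (S x) → n ≤ toℕ x + f) → wt f S ≡ 0 →
                ∀ w → T (S w) → GreedyAt w
  wt≡0⇒greedy zero S _ fuel _ w sw =
    contradiction (subst (n ≤_) (+-identityʳ _) (fuel w sw)) (<⇒≱ (toℕ<n w))
  wt≡0⇒greedy (suc f) S cv fuel wt≡0 w sw with minOf S in eq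
  ... | nothing = contradiction sw (minOf-nothing S eq w)
  ... | just v with minOf-just S eq
  ... | sv , least = at-w
    where
    S′ = remove S v
    term : Fin n → ℕ
    term u = count (λ x → component S′ u x ∧ (t v <F t x) ∧ (x <F u)) + wt f (component S′ u)
    term≡0 : ∀ {u} → T (S u) → T (adj v u) → term u ≡ 0
    term≡0 {u} su a =
      sum-map≡0⁻ term _ wt≡0 (foldr-keep⁺ (λ u → S u ∧ adj v u) (∈-allFin u) (∧-intro {S u} su a))
    s′⇒v< : ∀ {x} → T (S′ x) → v <ᶠ x
    s′⇒v< {x} p with remove⁻ S v x p
    ... | sx , x≢v = ≤∧≢⇒< (least x sx) (λ e → x≢v (sym (toℕ-injective e)))
    at-v : GreedyAt v
    at-v {u} {x} a v<u r tv<tx = ≮⇒≥ λ x<u →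
      foldr-tally≡0⁻ (λ x → component S′ u x ∧ (t v <F t x) ∧ (x <F u)) (m+n≡0⇒m≡0 _ (term≡0 su a)) (∈-allFin x)
        (∧-intro {component S′ u x} (reach⇒component S′ (inside r))
          (∧-intro {t v <F t x} (<⇒<ᵇ tv<tx) (<⇒<ᵇ x<u)))
      where
      su : T (S u)
      su = closed cv sv sv a (<⇒≤ v<u)
      in-S : ∀ {y} → T (S y) → v <ᶠ y → T (S′ y)
      in-S sy v<y = remove⁺ {S} sy (λ { refl → <-irrefl refl v<y })
      -- `closed` keeps a path on labels above `v` inside `S`, so the paths of `Greedy` do not leave
      -- the component that was counted.
      inside : ∀ {y} → Reach adj (v <ᶠ_) u y → Reach adj (InS S′) u y
      inside start = start
      inside (r ▸ (b , v<y)) with inside r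
      ... | r′ = r′ ▸ (b , in-S (closed cv sv (proj₁ (remove⁻ S v _ (reach-end (in-S su v<u) r′))) b (<⇒≤ v<y)) v<y)
    at-w : GreedyAt w
    at-w with w ≟ᶠ v
    ... | yes refl = at-v
    ... | no w≢v with last-before S sw w≢v (connected cv sw sv)
    ... | u , a , s′u , r = wt≡0⇒greedy f (component S′ u) (component-convex cv least s′u) fuel′
        (m+n≡0⇒n≡0 _ (term≡0 (proj₁ (remove⁻ S v u s′u)) (subst T (symmetric u v) a)))
        w (reach⇒component S′ (reach-sym symmetric (remove⁺ {S} sw w≢v) r))
      where
      fuel′ : ∀ x → T (component S′ u x) → n ≤ toℕ x + f
      fuel′ x cx = ≤-trans (subst (n ≤_) (+-suc _ f) (fuel v sv))
        (ℕ.+-monoˡ-≤ f (s′⇒v< (reach-end s′u (component⇒reach S′ cx))))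

weight≡0⇒greedy : ∀ {n} (A : FullyTieredTree n) → weight A ≡ 0 →
                  Greedy (FullyTieredTree.adj A) (FullyTieredTree.tier A)
weight≡0⇒greedy {n} A w≡0 {v} = WeightZero.wt≡0⇒greedy adj tier symmetric irreflexive n (λ _ → true)
    (record { connected = λ {x} {y} _ _ → walk⇒reach _ (connected x y) ; closed = λ _ _ _ _ → tt })
    (λ x _ → ℕ.m≤n+m n (toℕ x)) w≡0 v tt
  where
  open FullyTieredTree A
  open IsTree isTree

greedy⇒weight≡0 : ∀ {n} (A : FullyTieredTree n) →
                  Greedy (FullyTieredTree.adj A) (FullyTieredTree.tier A) → weight A ≡ 0
greedy⇒weight≡0 {n} A greedy = WeightZero.greedy⇒wt≡0 adj tier symmetric irreflexive greedy n (λ _ → true)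
  where
  open FullyTieredTree A
  open IsTree isTree

-- Cycles

module _ {A : Set} {R : A → A → Set} where

  linked-suffix : ∀ xs {ys} → Linked R (xs ++ ys) → Linked R ys
  linked-suffix []           l       = l
  linked-suffix (x ∷ []) {[]}    l   = []
  linked-suffix (x ∷ []) {_ ∷ _} (_ ∷ l) = l
  linked-suffix (x ∷ y ∷ xs) (_ ∷ l) = linked-suffix (y ∷ xs) l

  linked-prefix : ∀ xs {y ys} → Linked R (xs ++ y ∷ ys) → Linked R (xs ++ y ∷ [])
  linked-prefix []           l       = [-]
  linked-prefix (x ∷ [])     (r ∷ _) = r ∷ [-]
  linked-prefix (x ∷ y ∷ xs) (r ∷ l) = r ∷ linked-prefix (y ∷ xs) l

  linked-join : ∀ xs {y ys} → Linked R (xs ++ y ∷ []) → Linked R (y ∷ ys) → Linked R (xs ++ y ∷ ys)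
  linked-join []           _       l = l
  linked-join (x ∷ [])     (r ∷ _) l = r ∷ l
  linked-join (x ∷ y ∷ xs) (r ∷ k) l = r ∷ linked-join (y ∷ xs) k l

  Closed : List A → Set
  Closed []       = ⊤
  Closed (x ∷ xs) = Linked R (x ∷ xs ++ x ∷ [])

  rotate : ∀ ys {v zs} → Closed (ys ++ v ∷ zs) → Closed (v ∷ zs ++ ys)
  rotate []       {v} {zs} l = subst (λ ws → Linked R (v ∷ ws ++ v ∷ [])) (sym (++-identityʳ zs)) l
  rotate (a ∷ ys) {v} {zs} l =
    subst (Linked R) (cong (v ∷_) (sym (++-assoc zs (a ∷ ys) (v ∷ []))))
      (linked-join (v ∷ zs) (linked-suffix (a ∷ ys) l′) (linked-prefix (a ∷ ys) l′))
    where
    l′ : Linked R ((a ∷ ys) ++ (v ∷ zs ++ a ∷ []))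
    l′ = subst (Linked R) (++-assoc (a ∷ ys) (v ∷ zs) (a ∷ [])) l

module _ {n : ℕ} {adj : Fin n → Fin n → Bool} (symmetric : ∀ u v → adj u v ≡ adj v u) where

  before-last : ∀ {v} p xs → All (v <ᶠ_) xs → Linked (λ x y → T (adj x y)) (p ∷ xs ++ v ∷ []) →
                ∃ λ q → q ∈ p ∷ xs × T (adj q v) × Reach adj (v <ᶠ_) p q
  before-last p []       _          (a ∷ _) = p , here refl , a , start
  before-last p (y ∷ xs) (v<y ∷ v<) (a ∷ l) with before-last y xs v< l
  ... | q , q∈ , b , r = q , there q∈ , b , reach-trans (start ▸ (a , v<y)) r

  -- A cycle is read from its smallest vertex v: the two neighbours of v on it are
  -- distinct and joined by a path on labels > v.
  no-fork⇒acyclic : (∀ {v p q} → T (adj v p) → T (adj v q) → v <ᶠ p → v <ᶠ q → Reach adj (v <ᶠ_) p q → p ≡ q) →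
                    ¬ HasCycle adj
  no-fork⇒acyclic no-fork (a , b , c , rest , uniq , linked)
    with argmin∈ toℕ {P = λ _ → ⊤} (λ _ → yes tt) {xs = a ∷ b ∷ c ∷ rest} (here refl) tt
  ... | v , v∈ , _ , v≤ with ∈-∃++ v∈
  ... | ys , zs , eq = from-min (zs ++ ys) len unique-v lowest
    (rotate ys (subst Closed eq linked))
    where
    open Permutation (setoid (Fin n)) using (Unique-resp-↭; All-resp-↭; ++-comm; xs↭ys⇒|xs|≡|ys|)
    cycle↭ = ++-comm ys (v ∷ zs)
    unique-v : Unique (v ∷ zs ++ ys)
    unique-v = Unique-resp-↭ cycle↭ (subst Unique eq uniq)
    lowest : All (v ≤ᶠ_) (v ∷ zs ++ ys)
    lowest = All-resp-↭ (λ { refl → id }) cycle↭ (subst (All (v ≤ᶠ_)) eq (All.tabulate (λ x∈ → v≤ x∈ tt)))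
    len : 3 ≤ length (v ∷ zs ++ ys)
    len = subst (3 ≤_) (trans (cong length eq) (xs↭ys⇒|xs|≡|ys| cycle↭)) (s≤s (s≤s (s≤s z≤n)))
    from-min : ∀ xs → 3 ≤ length (v ∷ xs) → Unique (v ∷ xs) → All (v ≤ᶠ_) (v ∷ xs) →
               Closed {R = λ x y → T (adj x y)} (v ∷ xs) → ⊥
    from-min [] (s≤s ()) _ _ _
    from-min (_ ∷ []) (s≤s (s≤s ())) _ _ _
    -- The second neighbour `q` of `v` is the last entry of the cycle. With at least three vertices
    -- it is found in `y ∷ xs`, hence differs from `p`.
    from-min (p ∷ y ∷ xs) _ (v∉ ∷ p∉ ∷ _) (_ ∷ v≤) (vp ∷ py ∷ l)
      with All.zipWith (λ { (v≤x , v≢x) → ≤∧≢⇒< v≤x (λ e → v≢x (toℕ-injective e)) }) (v≤ , v∉)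
    ... | v<p ∷ v<y ∷ v<xs with before-last y xs v<xs l
    ... | q , q∈ , qv , r = All.lookup p∉ q∈
      (no-fork vp (subst T (symmetric q v) qv) v<p (All.lookup (v<y ∷ v<xs) q∈)
        (reach-trans (start ▸ (py , v<y)) r))

-- The common skeleton of both families.  Vertex zero is the root and par i is the
-- parent of vertex suc i; deleting the least vertex of a subtree leaves the subtrees
-- of its children, which are the components in the definition of the weight.
record Skeleton (m : ℕ) : Set where
  field
    par  : Fin m → Fin (suc m)
    par≤ : ∀ i → par i ≤ᶠ i
  open Ancestry par par≤ public
  field
    tier      : Fin (suc m) → Fin (suc m)
    tierBij   : Bijective _≡_ _≡_ tier
    overtaken : ∀ i → ∃ λ w → Anc (suc i) w × tier (par i) <ᶠ tier w

open Skeleton using (par; tier)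

record _≈ₛ_ {m : ℕ} (s s′ : Skeleton m) : Set where
  field
    par≡  : ∀ i → par s i ≡ par s′ i
    tier≡ : ∀ v → tier s v ≡ tier s′ v

open _≈ₛ_

Skeletons : ℕ → Setoid _ _
Skeletons m = record
  { Carrier = Skeleton m
  ; _≈_ = _≈ₛ_
  ; isEquivalence = record
    { refl  = record { par≡ = λ _ → refl ; tier≡ = λ _ → refl }
    ; sym   = λ e → record { par≡ = λ i → sym (par≡ e i) ; tier≡ = λ v → sym (tier≡ e v) }
    ; trans = λ e f → record { par≡  = λ i → trans (par≡ e i) (par≡ f i)
                             ; tier≡ = λ v → trans (tier≡ e v) (tier≡ f v) }
    }
  }

≈ₛ-sym : ∀ {m} {s s′ : Skeleton m} → s ≈ₛ s′ → s′ ≈ₛ s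
≈ₛ-sym {m} = Setoid.sym (Skeletons m)

≈ₛ⇒anc : ∀ {m} {s s′ : Skeleton m} → s ≈ₛ s′ → ∀ {u w} → Skeleton.Anc s u w → Skeleton.Anc s′ u w
≈ₛ⇒anc {s = s} {s′} e {u} = go
  where
  open Skeleton s using (self; up)
  open Skeleton s′ using () renaming (self to self′; up to up′)
  go : ∀ {w} → Skeleton.Anc s u w → Skeleton.Anc s′ u w
  go self       = self′
  go (up {i} a) = up′ (subst (Skeleton.Anc s′ u) (par≡ e i) (go a))

-- Skeletons and fully tiered trees

module ToTree {m : ℕ} (s : Skeleton m) where
  open Skeleton s hiding (par; tier)

  private
    n = suc m

    heir-of : ∀ i → ∃ λ w → (Anc (suc i) w × tier s (par s i) <ᶠ tier s w)
                          × (∀ y → Anc (suc i) y × tier s (par s i) <ᶠ tier s y → w ≤ᶠ y)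
    heir-of i = argmin toℕ (λ w → anc? (suc i) w ×-dec (tier s (par s i) <ᶠ? tier s w)) (overtaken i)

  heir : Fin m → Fin n
  heir i = proj₁ (heir-of i)

  heir-anc : ∀ i → Anc (suc i) (heir i)
  heir-anc i = proj₁ (proj₁ (proj₂ (heir-of i)))

  heir-tier : ∀ i → tier s (par s i) <ᶠ tier s (heir i)
  heir-tier i = proj₂ (proj₁ (proj₂ (heir-of i)))

  heir-least : ∀ i {y} → Anc (suc i) y → tier s (par s i) <ᶠ tier s y → heir i ≤ᶠ y
  heir-least i a t = proj₂ (proj₂ (heir-of i)) _ (a , t)

  Edge : Fin n → Fin n → Set
  Edge x y = ∃ λ i → par s i ≡ x × heir i ≡ y

  edge? : ∀ x y → Dec (Edge x y)
  edge? x y = any? λ i → par s i ≟ᶠ x ×-dec heir i ≟ᶠ y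

  adjacent? : ∀ x y → Dec (Edge x y ⊎ Edge y x)
  adjacent? x y = edge? x y ⊎-dec edge? y x

  adj : Fin n → Fin n → Bool
  adj x y = ⌊ adjacent? x y ⌋

  adj⁻ : ∀ {x y} → T (adj x y) → Edge x y ⊎ Edge y x
  adj⁻ {x} {y} = toWitness {a? = adjacent? x y}

  adj⁺ : ∀ {x y} → Edge x y ⊎ Edge y x → T (adj x y)
  adj⁺ {x} {y} = fromWitness {a? = adjacent? x y}

  edge-< : ∀ {x y} → Edge x y → x <ᶠ y
  edge-< (i , refl , refl) = <-≤-trans (par<suc i) (anc-≤ (heir-anc i))

  adj-<⇒edge : ∀ {x y} → T (adj x y) → x <ᶠ y → Edge x y
  adj-<⇒edge a x<y with adj⁻ a
  ... | inj₁ e = e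
  ... | inj₂ e = contradiction (edge-< e) (ℕ.<-asym x<y)

  adj-sym : ∀ x y → adj x y ≡ adj y x
  adj-sym x y = T-injective (λ a → adj⁺ ([ inj₂ , inj₁ ]′ (adj⁻ a))) (λ a → adj⁺ ([ inj₂ , inj₁ ]′ (adj⁻ a)))

  adj-irrefl : ∀ x → adj x x ≡ false
  adj-irrefl x = T-injective (λ a → ⊥-elim ([ loop , loop ]′ (adj⁻ a))) λ ()
    where
    loop : ¬ Edge x x
    loop e = <-irrefl refl (edge-< e)

  -- The ends of an edge are comparable in the increasing tree. Hence an edge leaves the subtree of
  -- `suc i` only towards a proper ancestor of `suc i`, and the largest of these is `par s i`.
  subtree-closed : ∀ {i x y} → Anc (suc i) x → T (adj x y) → par s i <ᶠ y → Anc (suc i) y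
  subtree-closed {i} a xy par<y with adj⁻ xy
  ... | inj₁ (k , refl , refl) = anc-trans a (anc-trans (par-anc k) (heir-anc k))
  ... | inj₂ (k , refl , refl) with anc-chain a (heir-anc k)
  ... | inj₁ self   = contradiction refl (ℕ.<⇒≢ par<y)
  ... | inj₁ (up b) = b
  ... | inj₂ self   = contradiction refl (ℕ.<⇒≢ par<y)
  ... | inj₂ (up b) = contradiction (<-≤-trans (par<suc k) (anc-≤ b)) (ℕ.<-asym par<y)

  reach-in-subtree : ∀ {i x y} → Anc (suc i) x → Reach adj (par s i <ᶠ_) x y → Anc (suc i) y
  reach-in-subtree a start         = a
  reach-in-subtree a (r ▸ (e , l)) = subtree-closed (reach-in-subtree a r) e l

  -- A neighbour above `v` is the heir of a child of `v`, and a path on labels above `v` stays in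
  -- the subtree of that child. The subtrees of two children are disjoint.
  no-fork : ∀ {v p q} → T (adj v p) → T (adj v q) → v <ᶠ p → v <ᶠ q → Reach adj (v <ᶠ_) p q → p ≡ q
  no-fork vp vq v<p v<q r with adj-<⇒edge vp v<p | adj-<⇒edge vq v<q
  ... | i , refl , refl | j , e , refl =
    cong heir (siblings (sym e) (reach-in-subtree (heir-anc i) r) (heir-anc j))

  -- The edge below par i leads to the heir of suc i, from which one climbs to suc i
  -- inside the subtree of suc i.
  up-reach : ∀ i → Reach adj (par s i ≤ᶠ_) (par s i) (suc i)
  up-reach i = go i (>-wellFounded i)
    where
    -- `climb` calls `go j` only when `suc i ≤ par j ≤ j`, so the induction runs from large indices
    -- to small ones.
    go : ∀ i → Acc _>ᶠ_ i → Reach adj (par s i ≤ᶠ_) (par s i) (suc i)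
    go i (acc rs) = reach-trans
      (start ▸ (adj⁺ (inj₁ (i , refl , refl)) , <⇒≤ (edge-< (i , refl , refl))))
      (reach-map (≤-trans (<⇒≤ (par<suc i))) (reach-sym adj-sym ≤-refl (climb (heir-anc i))))
      where
      climb : ∀ {w} → Anc (suc i) w → Reach adj (suc i ≤ᶠ_) (suc i) w
      climb self = start
      climb (up {j} a) = reach-trans (climb a)
        (reach-map (≤-trans (anc-≤ a)) (go j (rs (≤-trans (anc-≤ a) (par≤ j)))))

  anc⇒reach : ∀ {u w} → Anc u w → Reach adj (u ≤ᶠ_) u w
  anc⇒reach self       = start
  anc⇒reach (up {j} a) = reach-trans (anc⇒reach a) (reach-map (≤-trans (anc-≤ a)) (up-reach j))

  -- Together with `anc⇒reach` this expresses ancestry through the graph alone, which is how `par`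
  -- is recovered from `adj`.
  reach⇒anc : ∀ {u w} → Reach adj (u ≤ᶠ_) u w → Anc u w
  reach⇒anc {zero}  {w} _ = zero-anc w
  reach⇒anc {suc i} r     = reach-in-subtree self (reach-map (≤-trans (par<suc i)) r)

  tree : FullyTieredTree n
  tree = record
    { adj     = adj
    ; isTree  = record
      { symmetric   = adj-sym
      ; irreflexive = adj-irrefl
      ; connected   = λ u v → walk-trans (walk-sym adj-sym (from-root u)) (from-root v)
      ; acyclic     = no-fork⇒acyclic adj-sym no-fork
      }
    ; tier    = tier s
    ; tierBij = tierBij
    ; tiered  = tiered
    }
    where
    from-root : ∀ v → Walk adj zero v
    from-root v = reach⇒walk (anc⇒reach (zero-anc v))
    tiered : ∀ v v′ → T (adj v v′) → v′ <ᶠ v → tier s v′ <ᶠ tier s v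
    tiered v v′ a v′<v with adj-<⇒edge (subst T (adj-sym v v′) a) v′<v
    ... | i , refl , refl = heir-tier i

  tree-greedy : Greedy adj (tier s)
  tree-greedy a v<u r tv<tx with adj-<⇒edge a v<u
  ... | i , refl , refl = heir-least i (reach-in-subtree (heir-anc i) r) tv<tx

  weighted-tree : Σ (FullyTieredTree n) (λ A → weight A ≡ 0)
  weighted-tree = tree , greedy⇒weight≡0 tree tree-greedy

open ToTree using (weighted-tree)

module _ {m : ℕ} where
  open Setoid (FTT₀ (suc m)) using () renaming (_≈_ to _≈ₜ_)

  weighted-tree-cong : ∀ {s s′ : Skeleton m} → s ≈ₛ s′ → weighted-tree s ≈ₜ weighted-tree s′
  weighted-tree-cong {s} {s′} e =
    (λ u v → T-injective (transport e) (transport (≈ₛ-sym e))) , tier≡ e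
    where
    heir≤ : ∀ {s s′ : Skeleton m} → s ≈ₛ s′ → ∀ i → ToTree.heir s i ≤ᶠ ToTree.heir s′ i
    heir≤ {s} {s′} e i = ToTree.heir-least s i (≈ₛ⇒anc (≈ₛ-sym e) (ToTree.heir-anc s′ i))
      (subst₂ _<ᶠ_ (sym (trans (cong (tier s) (par≡ e i)) (tier≡ e _))) (sym (tier≡ e _)) (ToTree.heir-tier s′ i))
    edge : ∀ {s s′ : Skeleton m} → s ≈ₛ s′ → ∀ {x y} → ToTree.Edge s x y → ToTree.Edge s′ x y
    edge e (i , p , h) = i , trans (sym (par≡ e i)) p
      , trans (toℕ-injective (≤-antisym (heir≤ (≈ₛ-sym e) i) (heir≤ e i))) h
    transport : ∀ {s s′ : Skeleton m} → s ≈ₛ s′ → ∀ {x y} → T (ToTree.adj s x y) → T (ToTree.adj s′ x y)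
    transport {s} {s′} e {x} {y} a =
      ToTree.adj⁺ s′ ([ inj₁ ∘ edge e , inj₂ ∘ edge e ]′ (ToTree.adj⁻ s {x} {y} a))

  -- The parent is the greatest proper ancestor. Reachability makes `par s i` a proper ancestor of
  -- `suc i` in `s′` too, so it cannot exceed `par s′ i`; the roles are then exchanged.
  weighted-tree-injective : ∀ {s s′ : Skeleton m} → weighted-tree s ≈ₜ weighted-tree s′ → s ≈ₛ s′
  weighted-tree-injective {s} {s′} (adj≡ , tier≡) = record
    { par≡  = λ i → toℕ-injective (≤-antisym (par-mono {s} {s′} adj≡ i) (par-mono {s′} {s} (λ u v → sym (adj≡ u v)) i))
    ; tier≡ = tier≡ }
    where
    par-mono : ∀ {s s′ : Skeleton m} → (∀ u v → ToTree.adj s u v ≡ ToTree.adj s′ u v) → ∀ i → par s i ≤ᶠ par s′ i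
    par-mono {s} {s′} adj≡ i = Skeleton.anc-≤ s′ (Skeleton.anc-par s′
      (ToTree.reach⇒anc s′ (transport (ToTree.up-reach s i)))
      (λ e → <-irrefl (cong toℕ e) (Skeleton.par<suc s i)))
      where
      transport : ∀ {P : Fin (suc m) → Set} {u x} → Reach (ToTree.adj s) P u x → Reach (ToTree.adj s′) P u x
      transport start             = start
      transport (_▸_ {y} {x} r (a , p)) = transport r ▸ (subst T (adj≡ y x) a , p)

-- From a tiered tree of weight zero to its skeleton

module FromTree {m : ℕ} (A : FullyTieredTree (suc m)) (weight≡0 : weight A ≡ 0) where
  open FullyTieredTree A using (adj; isTree; tierBij; tiered) renaming (tier to t)
  open IsTree isTree using (symmetric; connected)

  private
    n = suc m

  greedy : Greedy adj t
  greedy = weight≡0⇒greedy A weight≡0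

  -- w ⇝ u: u lies in the subtree that the weight recursion handles when it removes w.
  _⇝_ : Fin n → Fin n → Set
  w ⇝ u = Reach adj (w ≤ᶠ_) w u

  ⇝? : ∀ w u → Dec (w ⇝ u)
  ⇝? w u = map′ (reach-map toWitness ∘ component⇒reach S) (reach⇒component S ∘ reach-map fromWitness)
                (T? (Weight.component adj t S w u))
    where
    open Component adj t
    S : Fin n → Bool
    S x = ⌊ w ≤ᶠ? x ⌋

  ⇝-≤ : ∀ {w u} → w ⇝ u → w ≤ᶠ u
  ⇝-≤ = reach-end ≤-refl

  ⇝-trans : ∀ {w v u} → w ⇝ v → v ⇝ u → w ⇝ u
  ⇝-trans r r′ = reach-trans r (reach-map (≤-trans (⇝-≤ r)) r′)

  ⇝-chain : ∀ {a b u} → a ⇝ u → b ⇝ u → a ≤ᶠ b → a ⇝ b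
  ⇝-chain r r′ a≤b = reach-trans r (reach-map (≤-trans a≤b) (reach-sym symmetric ≤-refl r′))

  opaque
    -- The subtrees containing `suc i` are nested, and the parent is the root of the smallest one
    -- whose root is less than `suc i`. Connectedness supplies the candidate `zero`.
    par-of : ∀ i → ∃ λ w → (w <ᶠ suc i × w ⇝ suc i) × (∀ y → y <ᶠ suc i × y ⇝ suc i → y ≤ᶠ w)
    par-of i = argmax toℕ (λ w → w <ᶠ? suc i ×-dec ⇝? w (suc i))
      (zero , s≤s z≤n , walk⇒reach (λ _ → z≤n) (connected zero (suc i)))

  parent : Fin m → Fin n
  parent i = proj₁ (par-of i)

  parent-< : ∀ i → parent i <ᶠ suc i
  parent-< i = proj₁ (proj₁ (proj₂ (par-of i)))

  parent-≤ : ∀ i → parent i ≤ᶠ i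
  parent-≤ i = ≤-pred (parent-< i)

  parent-⇝ : ∀ i → parent i ⇝ suc i
  parent-⇝ i = proj₂ (proj₁ (proj₂ (par-of i)))

  parent-greatest : ∀ i {w} → w <ᶠ suc i → w ⇝ suc i → w ≤ᶠ parent i
  parent-greatest i w< r = proj₂ (proj₂ (par-of i)) _ (w< , r)

  open Ancestry parent parent-≤

  anc⇒⇝ : ∀ {u w} → Anc u w → u ⇝ w
  anc⇒⇝ self       = start
  anc⇒⇝ (up {i} a) = ⇝-trans (anc⇒⇝ a) (parent-⇝ i)

  -- If `u` differs from `suc i`, it is at most `parent i` by maximality. Since both reach `suc i`,
  -- `⇝-chain` gives `u ⇝ parent i`, a smaller instance.
  ⇝⇒anc : ∀ {u w} → u ⇝ w → Anc u w
  ⇝⇒anc {u} {w} = go w (<-wellFounded (toℕ w))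
    where
    go : ∀ w → Acc _<_ (toℕ w) → u ⇝ w → Anc u w
    go w _ r with u ≟ᶠ w
    go w _ r | yes refl = self
    go zero _ r | no u≢w = contradiction (toℕ-injective (ℕ.n≤0⇒n≡0 (⇝-≤ r))) u≢w
    go (suc i) (acc rs) r | no u≢w = up (go (parent i) (rs (parent-< i))
      (⇝-chain r (parent-⇝ i) (parent-greatest i (≤∧≢⇒< (⇝-≤ r) (u≢w ∘ toℕ-injective)) r)))

  -- The first label below `suc i` on the path could be followed back to `suc i` on labels not less
  -- than itself, so it would be at most `parent i`.
  above-parent : ∀ {i x} → parent i <ᶠ x → Reach adj (parent i <ᶠ_) (suc i) x → suc i ⇝ x
  above-parent p<x start = start
  above-parent {i} {x} p<x (_▸_ {y} r (a , _)) with ih ← above-parent (reach-end (parent-< i) r) r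
    with suc i ≤ᶠ? x
  ... | yes i≤x = ih ▸ (a , i≤x)
  ... | no i≰x = contradiction (parent-greatest i x<i x⇝i) (<⇒≱ p<x)
    where
    x<i : x <ᶠ suc i
    x<i = ≰⇒> i≰x
    x⇝i : x ⇝ suc i
    x⇝i = reach-trans (start ▸ (subst T (symmetric y x) a , ≤-trans (<⇒≤ x<i) (⇝-≤ ih)))
                      (reach-map (≤-trans (<⇒≤ x<i)) (reach-sym symmetric ≤-refl ih))

  -- `u` comes right after the last visit to `v`; from there on all labels exceed `v`.
  exit : ∀ {v x} → v <ᶠ x → v ⇝ x → ∃ λ u → v <ᶠ u × T (adj v u) × Reach adj (v <ᶠ_) x u
  exit v<x start = contradiction refl (ℕ.<⇒≢ v<x)
  exit {v} {x} v<x (_▸_ {y} r (a , _)) with m≤n⇒m<n∨m≡n (⇝-≤ r)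
  ... | inj₂ v≡y = x , v<x , subst (λ z → T (adj z x)) (sym (toℕ-injective v≡y)) a , start
  ... | inj₁ v<y with exit v<y r
  ... | u , v<u , b , r′ = u , v<u , b , reach-trans (start ▸ (subst T (symmetric y x) a , v<y)) r′

  adj-tier-< : ∀ {v u} → T (adj v u) → v <ᶠ u → t v <ᶠ t u
  adj-tier-< {v} {u} a = tiered u v (subst T (symmetric v u) a)

  -- The neighbour of `parent i` in the component of `suc i`. By the tiering condition it witnesses
  -- `overtaken`.
  overtaker : ∀ i → ∃ λ u → T (adj (parent i) u) × parent i <ᶠ u × Anc (suc i) u
  overtaker i with exit (parent-< i) (parent-⇝ i)
  ... | u , p<u , a , r = u , a , p<u , ⇝⇒anc (above-parent p<u r)

  skeleton : Skeleton m
  skeleton = record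
    { par       = parent
    ; par≤      = parent-≤
    ; tier      = t
    ; tierBij   = tierBij
    ; overtaken = λ i → let (u , a , p<u , b) = overtaker i in u , b , adj-tier-< a p<u
    }

  open ToTree skeleton using (Edge; heir; heir-anc; heir-tier; heir-least; adj⁺; adj⁻)

  -- Vanishing of the weight gives `u ≤ heir i`. The tiering condition makes `u` a candidate for the
  -- heir, which gives the converse.
  neighbour≡heir : ∀ {i u} → T (adj (parent i) u) → Anc (suc i) u → u ≡ heir i
  neighbour≡heir {i} {u} a b = toℕ-injective (≤-antisym
    (greedy a p<u (reach-trans (reach-sym symmetric (parent-< i) (inside (anc⇒⇝ b))) (inside (anc⇒⇝ (heir-anc i))))
      (heir-tier i))
    (heir-least i b (adj-tier-< a p<u)))
    where
    p<u : parent i <ᶠ u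
    p<u = <-≤-trans (parent-< i) (anc-≤ b)
    inside : ∀ {x} → suc i ⇝ x → Reach adj (parent i <ᶠ_) (suc i) x
    inside = reach-map (<-≤-trans (parent-< i))

  edge⇒adj : ∀ {x y} → Edge x y → T (adj x y)
  edge⇒adj (i , refl , refl) with overtaker i
  ... | u , a , _ , b = subst (T ∘ adj (parent i)) (neighbour≡heir a b) a

  adj⇒edge : ∀ {x y} → T (adj x y) → x <ᶠ y → Edge x y
  adj⇒edge {x} {y} a x<y with child-towards (⇝⇒anc (start ▸ (a , <⇒≤ x<y)))
  ... | inj₁ refl         = contradiction refl (ℕ.<⇒≢ x<y)
  ... | inj₂ (i , refl , b) = i , refl , sym (neighbour≡heir a b)

  skeleton-adj : ∀ u v → ToTree.adj skeleton u v ≡ adj u v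
  skeleton-adj u v = T-injective (λ a → backward (adj⁻ a)) forward
    where
    backward : Edge u v ⊎ Edge v u → T (adj u v)
    backward (inj₁ e) = edge⇒adj e
    backward (inj₂ e) = subst T (symmetric v u) (edge⇒adj e)
    forward : T (adj u v) → T (ToTree.adj skeleton u v)
    forward a with <-cmp (toℕ u) (toℕ v)
    ... | tri< u<v _ _ = adj⁺ (inj₁ (adj⇒edge a u<v))
    ... | tri≈ _ u≡v _ with toℕ-injective u≡v
    ... | refl = contradiction (trans (sym (to T-≡ a)) (IsTree.irreflexive isTree u)) λ ()
    forward a | tri> _ _ v<u = adj⁺ (inj₂ (adj⇒edge (subst T (symmetric u v) a) v<u))

skeletons⤖trees : ∀ m → Bijection (Skeletons m) (FTT₀ (suc m))
skeletons⤖trees m = record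
  { to        = weighted-tree
  ; cong      = weighted-tree-cong
  ; bijective = weighted-tree-injective , λ (A , w) →
      let open FromTree A w in
      skeleton , λ {s} e → let (p , q) = weighted-tree-cong {s = s} {skeleton} e in
                           (λ u v → trans (p u v) (skeleton-adj u v)) , q
  }

-- Skeletons and complete nonambiguous trees

module Geometry (A : List Point) where

  RightChild DownChild : Point → Point → Set
  RightChild p q = Y q ≡ Y p × X p < X q × (∀ r → r ∈ A → Y r ≡ Y q → X p < X r → ¬ X r < X q)
  DownChild  p q = X q ≡ X p × Y p < Y q × (∀ r → r ∈ A → X r ≡ X q → Y p < Y r → ¬ Y r < Y q)

  Rightward Downward : Point → Set
  Rightward p = ∃ λ q → q ∈ A × Y q ≡ Y p × X p < X q
  Downward  p = ∃ λ q → q ∈ A × X q ≡ X p × Y p < Y q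

  rightward? : ∀ p → Dec (Rightward p)
  rightward? p with none⊎least (λ x y → X x ≤ X y) (λ x y → ≤-total (X x) (X y)) ≤-trans
                               (λ q → Y q ℕ.≟ Y p ×-dec X p <? X q) A
  ... | inj₁ none             = no λ (q , q∈ , e) → none q∈ e
  ... | inj₂ (q , q∈ , e , _) = yes (q , q∈ , e)

  nearest-right : ∀ {p} → Rightward p → ∃ λ q → q ∈ A × RightChild p q
  nearest-right {p} (_ , r∈ , right)
    with argmin∈ X (λ q → Y q ℕ.≟ Y p ×-dec X p <? X q) r∈ right
  ... | q , q∈ , (e , l) , least =
    q , q∈ , e , l , λ r r∈ f l′ → ℕ.≤⇒≯ (least r∈ (trans f e , l′))

  nearest-down : ∀ {p} → Downward p → ∃ λ q → q ∈ A × DownChild p q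
  nearest-down {p} (_ , r∈ , down)
    with argmin∈ Y (λ q → X q ℕ.≟ X p ×-dec Y p <? Y q) r∈ down
  ... | q , q∈ , (e , l) , least =
    q , q∈ , e , l , λ r r∈ f l′ → ℕ.≤⇒≯ (least r∈ (trans f e , l′))

  right-unique : ∀ {p q q′} → q ∈ A → q′ ∈ A → RightChild p q → RightChild p q′ → q ≡ q′
  right-unique q∈ q′∈ (e , l , min) (e′ , l′ , min′) =
    cong₂ _,_ (≤-antisym (≮⇒≥ (min _ q′∈ (trans e′ (sym e)) l′)) (≮⇒≥ (min′ _ q∈ (trans e (sym e′)) l)))
              (trans e (sym e′))

  down-unique : ∀ {p q q′} → q ∈ A → q′ ∈ A → DownChild p q → DownChild p q′ → q ≡ q′
  down-unique q∈ q′∈ (e , l , min) (e′ , l′ , min′) =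
    cong₂ _,_ (trans e (sym e′))
              (≤-antisym (≮⇒≥ (min _ q′∈ (trans e′ (sym e)) l′)) (≮⇒≥ (min′ _ q∈ (trans e (sym e′)) l)))

  TwoChildren : Point → Set
  TwoChildren p = Σ Point λ q₁ → Σ Point λ q₂ → q₁ ≢ q₂ × Child A p q₁ × Child A p q₂ ×
                    (∀ q → Child A p q → q ≡ q₁ ⊎ q ≡ q₂)

  two-children : ∀ {p} → Rightward p → Downward p → TwoChildren p
  two-children r d with nearest-right r | nearest-down d
  ... | q₁ , q₁∈ , c₁ | q₂ , q₂∈ , c₂ =
    q₁ , q₂ , (λ { refl → ℕ.<⇒≢ (proj₁ (proj₂ c₂)) (sym (proj₁ c₁)) })
    , (q₁∈ , inj₁ c₁) , (q₂∈ , inj₂ c₂)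
    , λ { q (q∈ , inj₁ c) → inj₁ (right-unique q∈ q₁∈ c c₁)
        ; q (q∈ , inj₂ c) → inj₂ (down-unique q∈ q₂∈ c c₂) }

  childless : ∀ {p} → ¬ Rightward p → ¬ Downward p → ∀ q → ¬ Child A p q
  childless ¬r ¬d q (q∈ , inj₁ (e , l , _)) = ¬r (q , q∈ , e , l)
  childless ¬r ¬d q (q∈ , inj₂ (e , l , _)) = ¬d (q , q∈ , e , l)

-- Rows of a nonambiguous tree are numbered downwards, tiers upwards.
level : ∀ {n} → Fin n → ℕ
level h = suc (toℕ (opposite h))

module _ {n : ℕ} where

  level-≤ : ∀ {h h′ : Fin n} → h ≤ᶠ h′ → level h′ ≤ level h
  level-≤ {h} {h′} h≤h′ rewrite opposite-prop h | opposite-prop h′ = s≤s (∸-monoʳ-≤ n (s≤s h≤h′))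

  level-< : ∀ {h h′ : Fin n} → h <ᶠ h′ → level h′ < level h
  level-< {h} {h′} h<h′ rewrite opposite-prop h | opposite-prop h′ = s≤s (∸-monoʳ-< (s≤s h<h′) (toℕ<n h′))

  level-<⁻ : ∀ (h h′ : Fin n) → level h′ < level h → h <ᶠ h′
  level-<⁻ h h′ l = ≰⇒> λ h′≤h → <⇒≱ l (level-≤ h′≤h)

  level-injective : ∀ (h h′ : Fin n) → level h ≡ level h′ → h ≡ h′
  level-injective h h′ e = trans (sym (opposite-involutive h))
    (trans (cong opposite (toℕ-injective (suc-injective e))) (opposite-involutive h′))

  column : ∀ {x} → 1 ≤ x → x ≤ n → ∃ λ (c : Fin n) → suc (toℕ c) ≡ x
  column {suc x} _ x≤n = fromℕ< x≤n , cong suc (toℕ-fromℕ< x≤n)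

  level-surjective : ∀ {y} → 1 ≤ y → y ≤ n → ∃ λ (h : Fin n) → level h ≡ y
  level-surjective 1≤y y≤n with column 1≤y y≤n
  ... | c , e = opposite c , trans (cong (suc ∘ toℕ) (opposite-involutive c)) e

  point : Fin n → Fin n → Point
  point c h = suc (toℕ c) , level h

  point-injective : ∀ c c′ h h′ → point c h ≡ point c′ h′ → c ≡ c′ × h ≡ h′
  point-injective c c′ h h′ e = toℕ-injective (suc-injective (cong X e)) , level-injective h h′ (cong Y e)

-- From a skeleton to its complete nonambiguous tree

module ToCNT {m : ℕ} (s : Skeleton m) where
  open Skeleton s hiding (par; tier)

  private
    n = suc m

  opaque
    top-of : ∀ c → ∃ λ w → Anc c w × (∀ y → Anc c y → tier s y ≤ᶠ tier s w)
    top-of c = argmax (toℕ ∘ tier s) (anc? c) (c , self)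

  top : Fin n → Fin n
  top c = proj₁ (top-of c)

  top-anc : ∀ c → Anc c (top c)
  top-anc c = proj₁ (proj₂ (top-of c))

  peak : Fin n → Fin n
  peak c = tier s (top c)

  tier≤peak : ∀ {c w} → Anc c w → tier s w ≤ᶠ peak c
  tier≤peak {c} a = proj₂ (proj₂ (top-of c)) _ a

  peak-anti : ∀ {a b} → Anc a b → peak b ≤ᶠ peak a
  peak-anti {b = b} a = tier≤peak (anc-trans a (top-anc b))

  par<peak : ∀ i → tier s (par s i) <ᶠ peak (suc i)
  par<peak i with overtaken i
  ... | w , a , l = <-≤-trans l (tier≤peak a)

  tier-injective : ∀ {x y} → tier s x ≡ tier s y → x ≡ y
  tier-injective = proj₁ tierBij

  -- The inner point of column par i whose right child is the topmost point of column suc i.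
  inner : Fin m → Point
  inner i = point (par s i) (peak (suc i))

  leaf : Fin n → Point
  leaf x = point x (tier s x)

  points : List Point
  points = map leaf (allFin n) ++ map inner (allFin m)

  Occupied : Fin n → Fin n → Set
  Occupied c h = tier s c ≡ h ⊎ ∃ λ i → par s i ≡ c × peak (suc i) ≡ h

  occupied⇒∈ : ∀ {c h} → Occupied c h → point c h ∈ points
  occupied⇒∈ (inj₁ refl)             = ∈-++⁺ˡ (∈-map⁺ leaf (∈-allFin _))
  occupied⇒∈ (inj₂ (i , refl , refl)) = ∈-++⁺ʳ (map leaf (allFin n)) (∈-map⁺ inner (∈-allFin i))

  ∈⇒occupied : ∀ {p} → p ∈ points → ∃₂ λ c h → p ≡ point c h × Occupied c h
  ∈⇒occupied p∈ with ∈-++⁻ (map leaf (allFin n)) p∈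
  ... | inj₁ q with ∈-map⁻ leaf q
  ... | x , _ , e = x , tier s x , e , inj₁ refl
  ∈⇒occupied p∈ | inj₂ q with ∈-map⁻ inner q
  ... | i , _ , e = par s i , peak (suc i) , e , inj₂ (i , refl , refl)

  point∈⇒occupied : ∀ {c h} → point c h ∈ points → Occupied c h
  point∈⇒occupied {c} {h} p∈ with ∈⇒occupied p∈
  ... | c′ , h′ , e , o with point-injective c c′ h h′ e
  ... | refl , refl = o

  -- Row `h` has its leaf in the column with tier `h`, and an inner point takes its row from the top
  -- descendant of a child. So the columns met by a row are ancestors of one vertex and form a
  -- chain, with the leaf at the right end.
  owner : ∀ {c h} → Occupied c h → ∃ λ w → tier s w ≡ h × Anc c w
  owner {c} (inj₁ e)              = c , e , self
  owner     (inj₂ (i , refl , e)) = top (suc i) , e , anc-trans (par-anc i) (top-anc (suc i))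

  tier≤occupied : ∀ {c h} → Occupied c h → tier s c ≤ᶠ h
  tier≤occupied (inj₁ refl)             = ≤-refl
  tier≤occupied (inj₂ (i , refl , refl)) = <⇒≤ (par<peak i)

  occupied≤peak : ∀ {c h} → Occupied c h → h ≤ᶠ peak c
  occupied≤peak o with owner o
  ... | w , refl , a = tier≤peak a

  peak-occupied : ∀ c → Occupied c (peak c)
  peak-occupied c with child-towards (top-anc c)
  ... | inj₁ c≡top          = inj₁ (cong (tier s) c≡top)
  ... | inj₂ (i , refl , a) = inj₂ (i , refl , toℕ-injective (≤-antisym (peak-anti (par-anc i)) (tier≤peak a)))

  -- The points of a row to the left of column c lie on the ancestor path of c above which
  -- the peak does not change.
  row-left : ∀ {c c′ h} → Occupied c h → Occupied c′ h → c′ <ᶠ c →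
             h ≡ peak c × ∃ λ i → c ≡ suc i × c′ ≤ᶠ par s i
  row-left {c} {c′} o o′ c′<c with owner o
  row-left {c} {c′} o (inj₁ e) c′<c | w , e′ , a with tier-injective (trans e (sym e′))
  ... | refl = contradiction (anc-≤ a) (<⇒≱ c′<c)
  row-left {c} {c′} o (inj₂ (j , refl , refl)) c′<c | w , e′ , a with tier-injective e′
  ... | refl with anc-chain a (top-anc (suc j))
  ... | inj₁ self   = refl , j , refl , ≤-refl
  ... | inj₁ (up b) = contradiction (anc-≤ b) (<⇒≱ c′<c)
  ... | inj₂ self   = refl , j , refl , ≤-refl
  ... | inj₂ (up {i} b) = toℕ-injective (≤-antisym (tier≤peak a) (peak-anti (up b)))
                        , i , refl , <⇒≤ (<-≤-trans (par<suc j) (anc-≤ b))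

  -- Equal rows mean equal top descendants, as `tier` is injective, and siblings with a common
  -- descendant coincide.
  inner-injective : ∀ {i j} → inner i ≡ inner j → i ≡ j
  inner-injective {i} {j} e with point-injective (par s i) (par s j) (peak (suc i)) (peak (suc j)) e
  ... | par≡ , peak≡ = siblings par≡ (top-anc (suc i))
    (subst (Anc (suc j)) (sym (tier-injective peak≡)) (top-anc (suc j)))

  open Geometry points

  leaf-no-right : ∀ x → ¬ Rightward (leaf x)
  leaf-no-right x (q , q∈ , e , l) with ∈⇒occupied q∈
  ... | c , h , refl , o with level-injective h (tier s x) e | owner o
  ... | refl | w , f , a with tier-injective f
  ... | refl = <⇒≱ (≤-pred l) (anc-≤ a)

  leaf-no-down : ∀ x → ¬ Downward (leaf x)
  leaf-no-down x (q , q∈ , e , l) with ∈⇒occupied q∈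
  ... | c , h , refl , o with toℕ-injective {i = c} {x} (suc-injective e)
  ... | refl = <⇒≱ (level-<⁻ h (tier s x) l) (tier≤occupied o)

  inner-right : ∀ i → Rightward (inner i)
  inner-right i = leaf (top (suc i)) , occupied⇒∈ (inj₁ refl) , refl
                , s≤s (<-≤-trans (par<suc i) (anc-≤ (top-anc (suc i))))

  inner-down : ∀ i → Downward (inner i)
  inner-down i = leaf (par s i) , occupied⇒∈ (inj₁ refl) , refl , level-< (par<peak i)

  complete : Complete points
  complete p p∈ with ∈⇒occupied p∈
  ... | x , _ , refl , inj₁ refl             = inj₁ (childless (leaf-no-right x) (leaf-no-down x))
  ... | _ , _ , refl , inj₂ (i , refl , refl) = inj₂ (two-children (inner-right i) (inner-down i))

  internalCount : InternalCount points m
  internalCount = map inner (allFin m) , Unique.map⁺ inner-injective (Unique.allFin⁺ m)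
    , (λ p → listed⇒internal , internal⇒listed)
    , trans (length-map inner (allFin m)) (length-tabulate id)
    where
    listed⇒internal : ∀ {p} → p ∈ map inner (allFin m) → p ∈ points × Internal points p
    listed⇒internal p∈ with ∈-map⁻ inner p∈
    ... | i , _ , refl with nearest-right (inner-right i)
    ... | q , q∈ , c = occupied⇒∈ (inj₂ (i , refl , refl)) , q , q∈ , inj₁ c
    internal⇒listed : ∀ {p} → p ∈ points × Internal points p → p ∈ map inner (allFin m)
    internal⇒listed (p∈ , q , c) with ∈⇒occupied p∈
    ... | x , _ , refl , inj₁ refl = contradiction c (childless (leaf-no-right x) (leaf-no-down x) q)
    ... | _ , _ , refl , inj₂ (i , refl , refl) = ∈-map⁺ inner (∈-allFin i)

  -- Every vertex descends from `zero`, including the one of highest tier. This puts the root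
  -- `(1 , 1)` into the set.
  peak-zero : level (peak zero) ≡ 1
  peak-zero with level-surjective {n} {1} ≤-refl (s≤s z≤n)
  ... | h , e with proj₂ tierBij h
  ... | w , f with f refl
  ... | refl = ≤-antisym (subst (level (peak zero) ≤_) e (level-≤ (tier≤peak (zero-anc w)))) (s≤s z≤n)

  row⊎col : ∀ c {h} → Occupied c h → point c h ≢ (1 , 1) →
            RowPred points (point c h) ⊎ ColPred points (point c h)
  row⊎col c {h} o p≢ with h ≟ᶠ peak c
  row⊎col c       o p≢ | no h≢ = inj₂ (point c (peak c) , occupied⇒∈ (peak-occupied c) , refl
                                      , level-< (≤∧≢⇒< (occupied≤peak o) (h≢ ∘ toℕ-injective)))
  row⊎col zero    o p≢ | yes refl = contradiction (cong (1 ,_) peak-zero) p≢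
  row⊎col (suc i) o p≢ | yes refl =
    inj₁ (inner i , occupied⇒∈ (inj₂ (i , refl , refl)) , refl , s≤s (par<suc i))

  unambiguous : ∀ {p} → p ∈ points → p ≢ (1 , 1) →
                (RowPred points p ⊎ ColPred points p) × ¬ (RowPred points p × ColPred points p)
  unambiguous p∈ p≢ with ∈⇒occupied p∈
  ... | c , h , refl , o = row⊎col c o p≢ , ¬both
    where
    -- By `row-left`, a point with something to its left is the top of its column.
    ¬both : ¬ (RowPred points (point c h) × ColPred points (point c h))
    ¬both ((q , q∈ , e , l) , (r , r∈ , f , k)) with ∈⇒occupied q∈ | ∈⇒occupied r∈
    ... | c₁ , h₁ , refl , o₁ | c₂ , h₂ , refl , o₂
      with level-injective h₁ h e | toℕ-injective {i = c₂} {c} (suc-injective f)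
    ... | refl | refl = <⇒≱ (level-<⁻ h h₂ k) (subst (h₂ ≤ᶠ_) (sym (proj₁ (row-left o o₁ (≤-pred l)))) (occupied≤peak o₂))

  nonambiguous : IsNonambiguous points
  nonambiguous = record
    { positive = positive
    ; root     = subst (λ y → (1 , y) ∈ points) peak-zero (occupied⇒∈ (peak-occupied zero))
    ; unambig  = unambiguous
    ; noEmptyX = no-empty-column
    ; noEmptyY = no-empty-row
    }
    where
    positive : ∀ {p} → p ∈ points → 1 ≤ X p × 1 ≤ Y p
    positive p∈ with ∈⇒occupied p∈
    ... | _ , _ , refl , _ = s≤s z≤n , s≤s z≤n
    no-empty-column : ∀ {p} → p ∈ points → ∀ x → 1 ≤ x → x < X p → ∃ λ q → q ∈ points × X q ≡ x
    no-empty-column p∈ x 1≤x x<p with ∈⇒occupied p∈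
    ... | c , _ , refl , _ with column {n} 1≤x (<⇒≤ (<-≤-trans x<p (toℕ<n c)))
    ... | c′ , e = leaf c′ , occupied⇒∈ (inj₁ refl) , e
    no-empty-row : ∀ {p} → p ∈ points → ∀ y → 1 ≤ y → y < Y p → ∃ λ q → q ∈ points × Y q ≡ y
    no-empty-row p∈ y 1≤y y<p with ∈⇒occupied p∈
    ... | _ , h , refl , _ with level-surjective {n} 1≤y (<⇒≤ (<-≤-trans y<p (toℕ<n (opposite h))))
    ... | h′ , e with proj₂ tierBij h′
    ... | x , f = leaf x , occupied⇒∈ (inj₁ refl) , trans (cong level (f refl)) e

  cnt : Σ (List Point) (λ A → IsNonambiguous A × Complete A × InternalCount A m)
  cnt = points , nonambiguous , complete , internalCount

open ToCNT using (cnt)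

module _ {m : ℕ} where
  open Setoid (CNT m) using () renaming (_≈_ to _≈ₙ_)
  open ToCNT

  cnt-cong : ∀ {s s′ : Skeleton m} → s ≈ₛ s′ → cnt s ≈ₙ cnt s′
  cnt-cong e p = transport e , transport (≈ₛ-sym e)
    where
    peak≤ : ∀ {s s′ : Skeleton m} → s ≈ₛ s′ → ∀ c → peak s c ≤ᶠ peak s′ c
    peak≤ {s} {s′} e c = subst (_≤ᶠ peak s′ c) (sym (tier≡ e (top s c))) (tier≤peak s′ (≈ₛ⇒anc e (top-anc s c)))
    peak≡ : ∀ {s s′ : Skeleton m} → s ≈ₛ s′ → ∀ c → peak s c ≡ peak s′ c
    peak≡ e c = toℕ-injective (≤-antisym (peak≤ e c) (peak≤ (≈ₛ-sym e) c))
    occupied : ∀ {s s′ : Skeleton m} → s ≈ₛ s′ → ∀ {c h} → Occupied s c h → Occupied s′ c h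
    occupied e (inj₁ f)             = inj₁ (trans (sym (tier≡ e _)) f)
    occupied e (inj₂ (i , f , g)) = inj₂ (i , trans (sym (par≡ e i)) f , trans (sym (peak≡ e (suc i))) g)
    transport : ∀ {s s′ : Skeleton m} → s ≈ₛ s′ → p ∈ points s → p ∈ points s′
    transport {s} {s′} e p∈ with ∈⇒occupied s p∈
    ... | c , h , refl , o = occupied⇒∈ s′ (occupied e o)

  -- The leaf is the lowest point of its column and the peak the highest, so both depend on the
  -- point set only. So does `par`: by `row-left` it is the last column with a point to the left of
  -- the top of column `suc i`.
  cnt-injective : ∀ {s s′ : Skeleton m} → cnt s ≈ₙ cnt s′ → s ≈ₛ s′
  cnt-injective {s} {s′} same = record
    { par≡  = λ i → toℕ-injective (≤-antisym (par-mono {s} {s′} forth back i) (par-mono {s′} {s} back forth i))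
    ; tier≡ = λ c → toℕ-injective (≤-antisym (tier≤occupied s (back (inj₁ refl))) (tier≤occupied s′ (forth (inj₁ refl)))) }
    where
    forth : ∀ {c h} → Occupied s c h → Occupied s′ c h
    forth o = point∈⇒occupied s′ (proj₁ (same _) (occupied⇒∈ s o))
    back : ∀ {c h} → Occupied s′ c h → Occupied s c h
    back o = point∈⇒occupied s (proj₂ (same _) (occupied⇒∈ s′ o))
    par-mono : ∀ {s s′ : Skeleton m} → (∀ {c h} → Occupied s c h → Occupied s′ c h) →
            (∀ {c h} → Occupied s′ c h → Occupied s c h) → ∀ i → par s i ≤ᶠ par s′ i
    par-mono {s} {s′} f g i with row-left s′ {c = suc i} (peak-occupied s′ (suc i))
        (subst (Occupied s′ (par s i)) peak≡ (f (inj₂ (i , refl , refl)))) (Skeleton.par<suc s i)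
      where
      peak≡ : peak s (suc i) ≡ peak s′ (suc i)
      peak≡ = toℕ-injective (≤-antisym (occupied≤peak s′ (f (peak-occupied s (suc i))))
                                       (occupied≤peak s (g (peak-occupied s′ (suc i)))))
    ... | _ , _ , refl , l = l

-- Leaves and dimensions of a complete nonambiguous tree

matching⇒≤ : ∀ {a b} (R : Fin a → Fin b → Set) → (∀ i → ∃ (R i)) →
             (∀ {i i′ j} → R i j → R i′ j → i ≡ i′) → a ≤ b
matching⇒≤ R total injective = injective⇒≤ {f = proj₁ ∘ total} λ {i} {i′} e →
  injective (proj₂ (total i)) (subst (R i′) (sym e) (proj₂ (total i′)))

later-column : ∀ {n x} → 2 ≤ x → x ≤ suc n → ∃ λ (i : Fin n) → suc (suc (toℕ i)) ≡ x
later-column (s≤s 1≤x) (s≤s x≤n) with column 1≤x x≤n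
... | i , e = i , cong suc e

module CompleteTree {A : List Point} (nonambiguous : IsNonambiguous A) (complete : Complete A) where
  open IsNonambiguous nonambiguous
  open Geometry A

  -- A point has at most one child to the right and at most one below, so two distinct children are
  -- one of each.
  rightward⇔downward : ∀ {p} → p ∈ A → (Rightward p → Downward p) × (Downward p → Rightward p)
  rightward⇔downward {p} p∈ with complete p p∈
  ... | inj₁ none = (λ r → let (q , q∈ , c) = nearest-right r in contradiction (q∈ , inj₁ c) (none q))
                  , (λ d → let (q , q∈ , c) = nearest-down d in contradiction (q∈ , inj₂ c) (none q))
  ... | inj₂ (_ , _ , q₁≢q₂ , (q₁∈ , inj₁ c) , (q₂∈ , inj₁ d) , _) = contradiction (right-unique q₁∈ q₂∈ c d) q₁≢q₂
  ... | inj₂ (_ , _ , q₁≢q₂ , (q₁∈ , inj₂ c) , (q₂∈ , inj₂ d) , _) = contradiction (down-unique q₁∈ q₂∈ c d) q₁≢q₂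
  ... | inj₂ (_ , _ , _ , (q₁∈ , inj₁ (e , l , _)) , (q₂∈ , inj₂ (f , k , _)) , _) =
    (λ _ → _ , q₂∈ , f , k) , (λ _ → _ , q₁∈ , e , l)
  ... | inj₂ (_ , _ , _ , (q₁∈ , inj₂ (f , k , _)) , (q₂∈ , inj₁ (e , l , _)) , _) =
    (λ _ → _ , q₁∈ , f , k) , (λ _ → _ , q₂∈ , e , l)

  internal⇒rightward : ∀ {p} → p ∈ A → Internal A p → Rightward p
  internal⇒rightward p∈ (q , q∈ , inj₁ (e , l , _)) = q , q∈ , e , l
  internal⇒rightward p∈ (q , q∈ , inj₂ (e , l , _)) = proj₂ (rightward⇔downward p∈) (q , q∈ , e , l)

  Leaf : Point → Set
  Leaf p = p ∈ A × ¬ Rightward p × ¬ Downward p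

  ¬rightward⇒leaf : ∀ {p} → p ∈ A → ¬ Rightward p → Leaf p
  ¬rightward⇒leaf p∈ ¬r = p∈ , ¬r , ¬r ∘ proj₂ (rightward⇔downward p∈)

  leaf-lowest : ∀ {p q} → Leaf p → q ∈ A → X q ≡ X p → Y q ≤ Y p
  leaf-lowest (_ , _ , ¬d) q∈ e = ≮⇒≥ λ l → ¬d (_ , q∈ , e , l)

  leaf-rightmost : ∀ {p q} → Leaf p → q ∈ A → Y q ≡ Y p → X q ≤ X p
  leaf-rightmost (_ , ¬r , _) q∈ e = ≮⇒≥ λ l → ¬r (_ , q∈ , e , l)

  leaf-column-unique : ∀ {p q} → Leaf p → Leaf q → X p ≡ X q → p ≡ q
  leaf-column-unique p q e = cong₂ _,_ e (≤-antisym (leaf-lowest q (proj₁ p) e) (leaf-lowest p (proj₁ q) (sym e)))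

  leaf-row-unique : ∀ {p q} → Leaf p → Leaf q → Y p ≡ Y q → p ≡ q
  leaf-row-unique p q e = cong₂ _,_ (≤-antisym (leaf-rightmost q (proj₁ p) e) (leaf-rightmost p (proj₁ q) (sym e))) e

  column-leaf : ∀ {p} → p ∈ A → ∃ λ q → Leaf q × X q ≡ X p
  column-leaf {p} p∈ with argmax∈ Y (λ q → X q ℕ.≟ X p) p∈ refl
  ... | q , q∈ , e , low = q , (q∈ , ¬d ∘ proj₁ (rightward⇔downward q∈) , ¬d) , e
    where
    ¬d : ¬ Downward q
    ¬d (r , r∈ , f , l) = <⇒≱ l (low r∈ (trans f e))

  row-leaf : ∀ {p} → p ∈ A → ∃ λ q → Leaf q × Y q ≡ Y p
  row-leaf {p} p∈ with argmax∈ X (λ q → Y q ℕ.≟ Y p) p∈ refl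
  ... | q , q∈ , e , far = q , ¬rightward⇒leaf q∈ (λ (r , r∈ , f , l) → <⇒≱ l (far r∈ (trans f e))) , e

  column-top : ∀ {p} → p ∈ A → ∃ λ q → q ∈ A × X q ≡ X p × ¬ ColPred A q
  column-top {p} p∈ with argmin∈ Y (λ q → X q ℕ.≟ X p) p∈ refl
  ... | q , q∈ , e , high = q , q∈ , e , λ (r , r∈ , f , l) → <⇒≱ l (high r∈ (trans f e))

  column-top-unique : ∀ {p q} → p ∈ A → q ∈ A → ¬ ColPred A p → ¬ ColPred A q → X p ≡ X q → p ≡ q
  column-top-unique p∈ q∈ ¬p ¬q e = cong₂ _,_ e
    (≤-antisym (≮⇒≥ λ l → ¬p (_ , q∈ , sym e , l)) (≮⇒≥ λ l → ¬q (_ , p∈ , e , l)))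

  nearest-left : ∀ {p} → p ∈ A → RowPred A p → ∃ λ q → q ∈ A × RightChild q p
  nearest-left {p} p∈ (_ , r∈ , left)
    with argmax∈ X (λ q → Y q ℕ.≟ Y p ×-dec X q <? X p) r∈ left
  ... | q , q∈ , (e , l) , near = q , q∈ , sym e , l , λ r r∈ f k k′ → <⇒≱ k (near r∈ (f , k′))

  left-unique : ∀ {p q q′} → q ∈ A → q′ ∈ A → RightChild q p → RightChild q′ p → q ≡ q′
  left-unique q∈ q′∈ (e , l , near) (e′ , l′ , near′) = cong₂ _,_
    (≤-antisym (≮⇒≥ λ k → near′ _ q∈ (sym e) k l) (≮⇒≥ λ k → near _ q′∈ (sym e′) k l′))
    (trans (sym e) e′)

  -- The predecessor in the row forces `X p > 1`, so `p` is not the root and `unambig` excludes a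
  -- predecessor in the column.
  rightChild-top : ∀ {p q} → p ∈ A → q ∈ A → RightChild q p → ¬ ColPred A p
  rightChild-top {p} {q} p∈ q∈ (e , l , _) col =
    proj₂ (unambig p∈ p≢) ((q , q∈ , sym e , l) , col)
    where
    p≢ : p ≢ (1 , 1)
    p≢ refl = <⇒≱ l (proj₁ (positive q∈))

  branch : ∀ {p} → p ∈ A → 1 < X p → ∃₂ λ q t → q ∈ A × t ∈ A × X t ≡ X p × RightChild q t
  branch p∈ 1<x with column-top p∈
  ... | t , t∈ , e , ¬col with unambig t∈ (λ { refl → ℕ.<⇒≢ 1<x e })
  ... | inj₂ col , _ = contradiction col ¬col
  ... | inj₁ row , _ with nearest-left t∈ row
  ... | q , q∈ , c = q , t , q∈ , t∈ , e , c

  private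
    widest : ∃ λ p → p ∈ A × ⊤ × (∀ {q} → q ∈ A → ⊤ → X q ≤ X p)
    widest = argmax∈ X (λ _ → yes tt) root tt
    deepest : ∃ λ p → p ∈ A × ⊤ × (∀ {q} → q ∈ A → ⊤ → Y q ≤ Y p)
    deepest = argmax∈ Y (λ _ → yes tt) root tt

  opaque
    -- `w` is one less than the number of columns: it counts the columns beyond the first, which
    -- `width≡internal` compares with the internal points.
    width : ∃ λ w → (∀ {p} → p ∈ A → X p ≤ suc w) × (∀ x → 1 ≤ x → x ≤ suc w → ∃ λ q → q ∈ A × X q ≡ x)
    width with widest
    ... | (zero , _) , p∈ , _ , _ = contradiction (proj₁ (positive p∈)) λ ()
    ... | p@(suc w , _) , p∈ , _ , max = w , (λ q∈ → max q∈ tt) , fill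
      where
      fill : ∀ x → 1 ≤ x → x ≤ suc w → ∃ λ q → q ∈ A × X q ≡ x
      fill x 1≤x x≤ with m≤n⇒m<n∨m≡n x≤
      ... | inj₁ x< = noEmptyX p∈ x 1≤x x<
      ... | inj₂ e  = p , p∈ , sym e

    height : ∃ λ w → (∀ {p} → p ∈ A → Y p ≤ suc w) × (∀ y → 1 ≤ y → y ≤ suc w → ∃ λ q → q ∈ A × Y q ≡ y)
    height with deepest
    ... | (_ , zero) , p∈ , _ , _ = contradiction (proj₂ (positive p∈)) λ ()
    ... | p@(_ , suc w) , p∈ , _ , max = w , (λ q∈ → max q∈ tt) , fill
      where
      fill : ∀ y → 1 ≤ y → y ≤ suc w → ∃ λ q → q ∈ A × Y q ≡ y
      fill y 1≤y y≤ with m≤n⇒m<n∨m≡n y≤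
      ... | inj₁ y< = noEmptyY p∈ y 1≤y y<
      ... | inj₂ e  = p , p∈ , sym e

  private
    N M : ℕ
    N = proj₁ width
    M = proj₁ height

  -- Every row and every column contains exactly one leaf.
  height≡width : M ≡ N
  height≡width = suc-injective (≤-antisym
    (matching⇒≤ (λ j i → LeafAt i j) row-to-column λ { (p , l , x , y) (p′ , l′ , x′ , y′) →
      toℕ-injective (suc-injective (trans (sym y) (trans (cong Y (leaf-column-unique l l′ (trans x (sym x′)))) y′))) })
    (matching⇒≤ LeafAt column-to-row λ { (p , l , x , y) (p′ , l′ , x′ , y′) →
      toℕ-injective (suc-injective (trans (sym x) (trans (cong X (leaf-row-unique l l′ (trans y (sym y′)))) x′))) }))
    where
    LeafAt : Fin (suc N) → Fin (suc M) → Set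
    LeafAt i j = ∃ λ p → Leaf p × X p ≡ suc (toℕ i) × Y p ≡ suc (toℕ j)
    column-to-row : ∀ i → ∃ (LeafAt i)
    column-to-row i with proj₂ (proj₂ width) (suc (toℕ i)) (s≤s z≤n) (toℕ<n i)
    ... | _ , q∈ , x with column-leaf q∈
    ... | p , l , e with column (proj₂ (positive (proj₁ l))) (proj₁ (proj₂ height) (proj₁ l))
    ... | j , f = j , p , l , trans e x , sym f
    row-to-column : ∀ j → ∃ λ i → LeafAt i j
    row-to-column j with proj₂ (proj₂ height) (suc (toℕ j)) (s≤s z≤n) (toℕ<n j)
    ... | _ , q∈ , y with row-leaf q∈
    ... | p , l , e with column (proj₁ (positive (proj₁ l))) (proj₁ (proj₂ width) (proj₁ l))
    ... | i , f = i , p , l , sym f , trans e y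

  -- Sending an internal point to the column of its right child is a bijection onto
  -- the columns other than the first.
  width≡internal : ∀ {k} → InternalCount A k → N ≡ k
  width≡internal (L , unique , spec , refl) = ≤-antisym
    (matching⇒≤ Branch column-branch λ { (p , p∈ , x , c) (p′ , p′∈ , x′ , c′) →
      toℕ-injective (suc-injective (suc-injective (trans (sym x) (trans (cong X (right-unique p∈ p′∈ c c′)) x′)))) })
    (matching⇒≤ (λ l i → Branch i l) point-branch λ {l} {l′} → λ { (p , p∈ , x , c) (p′ , p′∈ , x′ , c′) →
      lookup-injective unique l l′ (same-left l l′ p∈ p′∈ (trans x (sym x′)) c c′) })
    where
    Branch : Fin N → Fin (length L) → Set
    Branch i l = ∃ λ p → p ∈ A × X p ≡ suc (suc (toℕ i)) × RightChild (lookup L l) p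
    listed : ∀ l → lookup L l ∈ A
    listed l = proj₁ (proj₁ (spec _) (∈-lookup l))
    -- Right children in one column coincide, both being its top, and a point has only one nearest
    -- left neighbour.
    same-left : ∀ l l′ {p p′} → p ∈ A → p′ ∈ A → X p ≡ X p′ →
                RightChild (lookup L l) p → RightChild (lookup L l′) p′ → lookup L l ≡ lookup L l′
    same-left l l′ p∈ p′∈ e c c′
      with column-top-unique p∈ p′∈ (rightChild-top p∈ (listed l) c) (rightChild-top p′∈ (listed l′) c′) e
    ... | refl = left-unique (listed l) (listed l′) c c′
    column-branch : ∀ i → ∃ (Branch i)
    column-branch i with proj₂ (proj₂ width) (suc (suc (toℕ i))) (s≤s z≤n) (s≤s (toℕ<n i))
    ... | _ , p∈ , x with branch p∈ (subst (1 <_) (sym x) (s≤s (s≤s z≤n)))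
    ... | q , t , q∈ , t∈ , e , c with proj₂ (spec q) (q∈ , t , t∈ , inj₁ c)
    ... | q∈L = index q∈L , t , t∈ , trans e x , subst (λ r → RightChild r t) (Any.lookup-index q∈L) c
    point-branch : ∀ l → ∃ λ i → Branch i l
    point-branch l with proj₁ (spec _) (∈-lookup l)
    ... | q∈ , int with nearest-right (internal⇒rightward q∈ int)
    ... | p , p∈ , c@(_ , q<p , _)
      with later-column (≤-trans (s≤s (proj₁ (positive q∈))) q<p) (proj₁ (proj₂ width) p∈)
    ... | i , f = i , p , p∈ , sym f , c

-- From a complete nonambiguous tree to its skeleton

module FromCNT {m : ℕ} {A : List Point} (nonambiguous : IsNonambiguous A) (complete : Complete A)
               (internalCount : InternalCount A m) where
  open IsNonambiguous nonambiguous
  open Geometry A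
  open CompleteTree nonambiguous complete

  private
    n = suc m

  opaque
    width≡ : proj₁ width ≡ m
    width≡ = width≡internal internalCount

    X≤n : ∀ {p} → p ∈ A → X p ≤ n
    X≤n {p} p∈ = subst (λ w → X p ≤ suc w) width≡ (proj₁ (proj₂ width) p∈)

    Y≤n : ∀ {p} → p ∈ A → Y p ≤ n
    Y≤n {p} p∈ = subst (λ w → Y p ≤ suc w) (trans height≡width width≡) (proj₁ (proj₂ height) p∈)

    column-inhabited : ∀ (c : Fin n) → ∃ λ p → p ∈ A × X p ≡ suc (toℕ c)
    column-inhabited c = proj₂ (proj₂ width) (suc (toℕ c)) (s≤s z≤n)
      (subst (λ w → suc (toℕ c) ≤ suc w) (sym width≡) (toℕ<n c))

    row-inhabited : ∀ (h : Fin n) → ∃ λ p → p ∈ A × Y p ≡ level h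
    row-inhabited h = proj₂ (proj₂ height) (level h) (s≤s z≤n)
      (subst (λ w → level h ≤ suc w) (sym (trans height≡width width≡)) (toℕ<n (opposite h)))

  as-point : ∀ {p} → p ∈ A → ∃₂ λ (c h : Fin n) → p ≡ point c h
  as-point p∈ with column (proj₁ (positive p∈)) (X≤n p∈) | level-surjective (proj₂ (positive p∈)) (Y≤n p∈)
  ... | c , e | h , f = c , h , cong₂ _,_ (sym e) (sym f)

  as-point-in-column : ∀ {p} c → p ∈ A → X p ≡ suc (toℕ c) → ∃ λ (h : Fin n) → p ≡ point c h
  as-point-in-column c p∈ e with as-point p∈
  ... | c′ , h , refl with toℕ-injective {i = c′} {c} (suc-injective e)
  ... | refl = h , refl

  as-point-in-row : ∀ {p} h → p ∈ A → Y p ≡ level h → ∃ λ (c : Fin n) → p ≡ point c h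
  as-point-in-row h p∈ e with as-point p∈
  ... | c , h′ , refl with level-injective h′ h e
  ... | refl = c , refl

  opaque
    leaf-of : ∀ (c : Fin n) → ∃ λ (h : Fin n) → Leaf (point c h)
    leaf-of c with column-inhabited c
    ... | _ , p∈ , x with column-leaf p∈
    ... | q , l , e with as-point-in-column c (proj₁ l) (trans e x)
    ... | h , refl = h , l

    branch-of : ∀ (i : Fin m) → ∃₂ λ (c h : Fin n) →
                point c h ∈ A × point (suc i) h ∈ A × RightChild (point c h) (point (suc i) h)
    branch-of i with column-inhabited (suc i)
    ... | _ , p∈ , x with branch p∈ (subst (1 <_) (sym x) (s≤s (s≤s z≤n)))
    ... | q , t , q∈ , t∈ , e , r with as-point-in-column (suc i) t∈ (trans e x)
    ... | h , refl with as-point-in-row h q∈ (sym (proj₁ r))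
    ... | c , refl = c , h , q∈ , t∈ , r

  tierOf : Fin n → Fin n
  tierOf c = proj₁ (leaf-of c)

  tierOf-leaf : ∀ c → Leaf (point c (tierOf c))
  tierOf-leaf c = proj₂ (leaf-of c)

  parent : Fin m → Fin n
  parent i = proj₁ (branch-of i)

  -- The height of the topmost point of column suc i.
  crest : Fin m → Fin n
  crest i = proj₁ (proj₂ (branch-of i))

  parent∈ : ∀ i → point (parent i) (crest i) ∈ A
  parent∈ i = proj₁ (proj₂ (proj₂ (branch-of i)))

  crest∈ : ∀ i → point (suc i) (crest i) ∈ A
  crest∈ i = proj₁ (proj₂ (proj₂ (proj₂ (branch-of i))))

  crest-child : ∀ i → RightChild (point (parent i) (crest i)) (point (suc i) (crest i))
  crest-child i = proj₂ (proj₂ (proj₂ (proj₂ (branch-of i))))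

  parent-≤ : ∀ i → parent i ≤ᶠ i
  parent-≤ i = ≤-pred (≤-pred (proj₁ (proj₂ (crest-child i))))

  leaf⇒tierOf : ∀ {c h} → Leaf (point c h) → tierOf c ≡ h
  leaf⇒tierOf {c} {h} l = level-injective (tierOf c) h (cong Y (leaf-column-unique (tierOf-leaf c) l refl))

  tierOf-bijective : Bijective _≡_ _≡_ tierOf
  tierOf-bijective = injective , surjective
    where
    injective : Injective _≡_ _≡_ tierOf
    injective {x} {y} e = toℕ-injective (suc-injective
      (cong X (leaf-row-unique (tierOf-leaf x) (tierOf-leaf y) (cong level e))))
    surjective : Surjective _≡_ _≡_ tierOf
    surjective h with row-inhabited h
    ... | _ , p∈ , y with row-leaf p∈
    ... | q , l , e with as-point-in-row h (proj₁ l) (trans e y)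
    ... | c , refl = c , λ { refl → leaf⇒tierOf l }

  crest-highest : ∀ i {h} → point (suc i) h ∈ A → h ≤ᶠ crest i
  crest-highest i {h} p∈ = ≮⇒≥ λ l →
    rightChild-top (crest∈ i) (parent∈ i) (crest-child i) (point (suc i) h , p∈ , refl , level-< l)

  -- By `rightChild-top` the nearest point to the right is the top of its column, and `point c h` is
  -- its only nearest left neighbour.
  rightward⇒crest : ∀ {c h} → point c h ∈ A → Rightward (point c h) → ∃ λ i → parent i ≡ c × crest i ≡ h
  rightward⇒crest {c} {h} p∈ r with nearest-right r
  ... | q , q∈ , child with as-point-in-row h q∈ (proj₁ child)
  ... | zero  , refl = contradiction (proj₁ (proj₂ child)) λ { (s≤s ()) }
  ... | suc i , refl with level-injective h (crest i)
        (cong Y (column-top-unique q∈ (crest∈ i) (rightChild-top q∈ p∈ child)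
          (rightChild-top (crest∈ i) (parent∈ i) (crest-child i)) refl))
  ... | refl = i , toℕ-injective (suc-injective (cong X (left-unique (parent∈ i) p∈ (crest-child i) child))) , refl

  open Ancestry parent parent-≤

  -- The row is followed to the right from the top of column `suc i`. Each step leads to a child
  -- column with the same crest, and the row ends at a leaf, whose column is the descendant wanted.
  crest-owner : ∀ i → ∃ λ w → Anc (suc i) w × tierOf w ≡ crest i
  crest-owner i = go i (>-wellFounded i)
    where
    go : ∀ i → Acc _>ᶠ_ i → ∃ λ w → Anc (suc i) w × tierOf w ≡ crest i
    go i (acc rs) with rightward? (point (suc i) (crest i))
    ... | no ¬r = suc i , self , leaf⇒tierOf (¬rightward⇒leaf (crest∈ i) ¬r)
    ... | yes r with rightward⇒crest (crest∈ i) r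
    ... | j , e , f with go j (rs (subst (_≤ toℕ j) (cong toℕ e) (parent-≤ j)))
    ... | w , a , g = w , anc-trans (subst (λ v → Anc v (suc j)) e (par-anc j)) a , trans g f

  parent-tier<crest : ∀ i → tierOf (parent i) <ᶠ crest i
  parent-tier<crest i = level-<⁻ (tierOf (parent i)) (crest i)
    (≤∧≢⇒< (leaf-lowest (tierOf-leaf (parent i)) (parent∈ i) refl) not-leaf)
    where
    not-leaf : level (crest i) ≢ level (tierOf (parent i))
    not-leaf e = proj₁ (proj₂ (tierOf-leaf (parent i)))
      (point (suc i) (crest i) , crest∈ i , e , s≤s (par<suc i))

  skeleton : Skeleton m
  skeleton = record
    { par       = parent
    ; par≤      = parent-≤
    ; tier      = tierOf
    ; tierBij   = tierOf-bijective
    ; overtaken = λ i → let (w , a , e) = crest-owner i in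
                        w , a , subst (tierOf (parent i) <ᶠ_) (sym e) (parent-tier<crest i)
    }

  open ToCNT skeleton using (peak; tier≤peak; top; top-anc; points; Occupied; occupied⇒∈; ∈⇒occupied)

  -- Crests do not fall on the way up to `suc i`, because `parent∈ j` places a point at height
  -- `crest j` in the parent column.
  below-crest : ∀ {i w h} → Anc (suc i) w → point w h ∈ A → h ≤ᶠ crest i
  below-crest {i} self   p∈ = crest-highest i p∈
  below-crest (up {j} a) p∈ = ≤-trans (crest-highest j p∈) (below-crest a (parent∈ j))

  peak≡crest : ∀ i → peak (suc i) ≡ crest i
  peak≡crest i with crest-owner i
  ... | w , a , e = toℕ-injective (≤-antisym
    (below-crest (top-anc (suc i)) (proj₁ (tierOf-leaf (top (suc i)))))
    (subst (_≤ᶠ peak (suc i)) e (tier≤peak a)))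

  occupied⇒∈A : ∀ {c h} → Occupied c h → point c h ∈ A
  occupied⇒∈A {c} (inj₁ refl)         = proj₁ (tierOf-leaf c)
  occupied⇒∈A (inj₂ (i , refl , refl)) = subst (λ h → point (parent i) h ∈ A) (sym (peak≡crest i)) (parent∈ i)

  ∈A⇒occupied : ∀ {c h} → point c h ∈ A → Occupied c h
  ∈A⇒occupied {c} {h} p∈ with rightward? (point c h)
  ... | no ¬r = inj₁ (leaf⇒tierOf (¬rightward⇒leaf p∈ ¬r))
  ... | yes r with rightward⇒crest p∈ r
  ... | i , e , f = inj₂ (i , e , trans (peak≡crest i) f)

  points⊆ : ∀ {p} → p ∈ points → p ∈ A
  points⊆ p∈ with ∈⇒occupied p∈
  ... | c , h , refl , o = occupied⇒∈A o

  ⊆points : ∀ {p} → p ∈ A → p ∈ points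
  ⊆points p∈ with as-point p∈
  ... | c , h , refl = occupied⇒∈ {c} {h} (∈A⇒occupied p∈)

skeletons⤖cnts : ∀ m → Bijection (Skeletons m) (CNT m)
skeletons⤖cnts m = record
  { to        = cnt
  ; cong      = λ {s} {s′} → cnt-cong {s = s} {s′}
  ; bijective = (λ {s} {s′} → cnt-injective {s = s} {s′}) , λ (A , nonambiguous , complete , count) →
      let open FromCNT nonambiguous complete count in
      skeleton , λ {s} e p → (points⊆ ∘ proj₁ (cnt-cong {s = s} {skeleton} e p))
                           , (proj₂ (cnt-cong {s = s} {skeleton} e p) ∘ ⊆points)
  }

theorem5p1 : (n : ℕ) → 1 ≤ n → Bijection (FTT₀ n) (CNT (n ∸ 1))
theorem5p1 (suc m) _ = Inverse⇒Bijection (Inverse.trans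
  (Inverse.sym (Bijection⇒Inverse (skeletons⤖trees m))) (Bijection⇒Inverse (skeletons⤖cnts m)))
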